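{- Fix $n$ and let $\mathcal{R}_B$ be the following set of term rewrite rules over the DeMorgan signature $\langle \land,\lor,\neg,0,1\rangle$ (with $g$ a variable): $$0\to\neg 1,\quad \neg\neg g\to g,\quad g\land g\to g,\quad g\lor g\to g,$$ $$g\land\neg 1\to\neg 1,\quad \neg 1\land g\to\neg 1,\quad g\lor 1\to 1,\quad 1\lor g\to 1,$$ $$g\land 1\to g,\quad 1\land g\to g,\quad g\lor\neg 1\to g,\quad \neg 1\lor g\to g,$$ $$g\land\neg g\to\neg 1,\quad \neg g\land g\to\neg 1,\quad g\lor\neg g\to 1,\quad \neg g\lor g\to 1.$$ $\mathcal{R}_B$ induces two term graph rewriting systems on DeMorgan circuits over inputs $x_1,\dots,x_n$: 1. the system $\mathcal{S}$, whose rewrite steps are the proper rewrite steps induced by $\mathcal{R}_B$ together with collapse steps, is convergent up to circuit isomorphism; and 2. the system $\mathcal{S}'$, whose rewrite steps are only the proper rewrite steps induced by $\mathcal{R}_B$ (no collapse steps), is convergent up to circuit bisimilarity.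
   Context: **Convergence.** A binary relation $\to$ on a set is *terminating* if there is no infinite path $a_0\to a_1\to\cdots$. It is *confluent* if whenever $a\to^* b$ and $a\to^* b'$ there is $c$ with $b\to^* c$ and $b'\to^* c$, where $\to^*$ is the reflexive-transitive closure. It is *convergent* if it is both. For an equivalence relation $\equiv$ on circuits, a rewrite relation $\to$ on circuits is *convergent up to $\equiv$* if the induced relation on $\equiv$-classes is convergent, where $[C]\to[D]$ iff there are $C'\equiv C$ and $D'\equiv D$ with $C'\to D'$. **Circuits as term graphs.** Let $X=\{x_1,\dots,x_n\}$ be input variables (arity $0$). The symbols $\land,\lor$ have arity 2, $\neg$ has arity 1, and $0,1$ have arity 0. A *hypergraph* is $G=\langle V_G,E_G,\mathrm{lab}_G,\mathrm{att}_G\rangle$ with $V_G,E_G$ finite sets of vertices and hyperedges, $\mathrm{lab}_G:E_G\to\{\land,\lor,\neg,0,1\}\cup X$, and $\mathrm{att}_G(e)=v_0v_1\cdots v_\ell$ a string of vertices of length $1+\mathrm{arity}(\mathrm{lab}_G(e))$. The vertex $v_0=\mathrm{res}(e)$ is the result node of $e$, and $v_1,\dots,v_\ell$ are its argument nodes. Paths go from result nodes to argument nodes. A *DeMorgan circuit* is a hypergraph that is a *term graph*: (1) there is a node $\mathrm{root}_G$ from which every node is reachable; (2) $G$ is acyclic; (3) each node is the result node of a unique edge. A *hypergraph morphism* $f:G\to H$ is a pair of maps $E_G\to E_H$, $V_G\to V_H$ preserving labels and (in order) attachment strings. An isomorphism is a bijective morphism. For a node $v$ of a term graph $G$, $\mathrm{term}_G(v)=\mathrm{lab}_G(e)(\mathrm{term}_G(v_1),\dots,\mathrm{term}_G(v_\ell))$,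 where $e$ is the unique edge with $\mathrm{res}(e)=v$ and $v_1,\dots,v_\ell$ are its argument nodes. Put $\mathrm{term}(G)=\mathrm{term}_G(\mathrm{root}_G)$. Circuits $G,H$ are *bisimilar* if $\mathrm{term}(G)=\mathrm{term}(H)$. **Proper rewrite steps.** For a term $t$ over the DeMorgan signature and the rule variable $g$, let $\diamond t$ be the parse tree of $t$ encoded as a hypergraph (one hyperedge per function or constant symbol occurrence), in which all occurrences of $g$ are replaced by one single "open" vertex $\gamma$ that is not the result node of any edge. If $t=g$, then $\diamond t$ is just $\gamma$, which is also its root. For a node $v$ of a circuit $G$, let $G[v]$ be the sub-hypergraph reachable from $v$. The pair $\langle v,\ell\to r\rangle$ is a *redex* in $G$ if there is a morphism $p:\diamond\ell\to G[v]$ sending the root of $\diamond\ell$ to $v$. The corresponding *proper rewrite step* transforms $G$ into $H$ as follows: (i) delete the unique edge $e$ with $\mathrm{res}(e)=v$; (ii) take the disjoint union with $\diamond r$, identify $v$ with the root of $\diamond r$, and, if $g$ occurs in $r$, identify the open vertex $\gamma$ of $\diamond r$ with $p(\gamma)$; (iii) delete all nodes and edges not reachable from the root (the root being the node into which $\mathrm{root}_G$ was carried by the identifications). **Collapse steps.** There is a collapse step from a circuit $C$ to a circuit $D$ if there is a non-injective hypergraph morphism $C\to D$ mapping $\mathrm{root}_C$ to $\mathrm{root}_D$. -}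

module Defs where

open import Level using (Level; _⊔_) renaming (suc to lsuc; zero to 0ℓ)
open import Data.Nat.Base using (ℕ; suc)
open import Data.Fin.Base using (Fin)
open import Data.Fin.Induction using (spo-wellFounded)
open import Data.Irrelevant as Irr using ()
open import Data.Product.Base using (∃; ∃₂; _×_; _,_; proj₁; proj₂)
open import Data.Product using (∃!)
open import Data.Refinement using (Refinement-syntax; value; _,_)
open import Data.Sum.Base using (_⊎_; inj₁; inj₂)
open import Data.Unit.Base using (⊤; tt)
open import Data.Vec.Base as Vec using (Vec; []; _∷_; head; tail; lookup; tabulate; toList)
open import Data.Vec.Membership.Propositional using (_∈_)
open import Data.Vec.Membership.Propositional.Properties using (∈-lookup)
open import Data.Vec.Properties using (tabulate-cong; tabulate-∘; tabulate∘lookup)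
open import Function.Base using (_∘_; flip)
open import Function.Bundles using (_↔_; _⇔_; Inverse)
open import Function.Definitions using (Injective; Surjective; Bijective)
open import Induction.WellFounded using (WellFounded; Acc; acc; module Subrelation)
open import Relation.Binary.Core using (Rel)
open import Relation.Binary.Structures using (IsStrictPartialOrder)
open import Relation.Binary.Construct.Closure.Equivalence using (EqClosure)
open import Relation.Binary.Construct.Closure.ReflexiveTransitive using (Star; ε; _◅_; _◅◅_)
open import Relation.Binary.Construct.Closure.Transitive using (TransClosure; [_]; _++_)
import Relation.Binary.Construct.On as On
open import Relation.Binary.Construct.Union using (_∪_)
open import Relation.Binary.PropositionalEquality
  using (_≡_; _≢_; refl; sym; cong; subst₂; isEquivalence; resp₂; module ≡-Reasoning)
open import Relation.Nullary.Negation.Core using (¬_)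

module _ {a ℓ₁ ℓ₂ : Level} {A : Set a} (_≈_ : Rel A ℓ₁) (_⟶_ : Rel A ℓ₂) where

  -- Relations on ≈-classes are given on representatives; accordingly the
  -- reflexive-transitive closure on classes is reflexive up to ≈.

  data StarUpTo : Rel A (a ⊔ ℓ₁ ⊔ ℓ₂) where
    done : ∀ {x y} → x ≈ y → StarUpTo x y
    step : ∀ {x y z} → x ⟶ y → StarUpTo y z → StarUpTo x z

  Terminating : Set (a ⊔ ℓ₂)
  Terminating = ¬ (∃ λ (path : ℕ → A) → ∀ i → path i ⟶ path (suc i))

  Confluent : Set (a ⊔ ℓ₁ ⊔ ℓ₂)
  Confluent = ∀ {x y y′} → StarUpTo x y → StarUpTo x y′ →
              ∃ λ z → StarUpTo y z × StarUpTo y′ z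

  Convergent : Set (a ⊔ ℓ₁ ⊔ ℓ₂)
  Convergent = Terminating × Confluent

  OnClasses : Rel A (a ⊔ ℓ₁ ⊔ ℓ₂)
  OnClasses x y = ∃₂ λ x′ y′ → x′ ≈ x × y′ ≈ y × x′ ⟶ y′

ConvergentUpTo : ∀ {a ℓ₁ ℓ₂ : Level} {A : Set a} →
                 Rel A ℓ₁ → Rel A ℓ₂ → Set (a ⊔ ℓ₁ ⊔ ℓ₂)
ConvergentUpTo _≈_ _⟶_ = Convergent _≈_ (OnClasses _≈_ _⟶_)

data Symbol : Set where
  ∧ˢ ∨ˢ ¬ˢ 0ˢ 1ˢ : Symbol

symbolArity : Symbol → ℕ
symbolArity ∧ˢ = 2
symbolArity ∨ˢ = 2
symbolArity ¬ˢ = 1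
symbolArity 0ˢ = 0
symbolArity 1ˢ = 0

data Term (X : Set) : Set where
  var : X → Term X
  op  : (s : Symbol) → Vec (Term X) (symbolArity s) → Term X

infixr 6 _∧ᵗ_
infixr 5 _∨ᵗ_
infix  8 ¬ᵗ_

pattern _∧ᵗ_ s t = op ∧ˢ (s ∷ t ∷ [])
pattern _∨ᵗ_ s t = op ∨ˢ (s ∷ t ∷ [])
pattern ¬ᵗ_ t    = op ¬ˢ (t ∷ [])
pattern 0ᵗ       = op 0ˢ []
pattern 1ᵗ       = op 1ˢ []

Pattern : Set
Pattern = Term ⊤

pattern g = var tt

infix 4 _▷_

data _▷_ : Pattern → Pattern → Set where
  0▷¬1    : 0ᵗ          ▷ ¬ᵗ 1ᵗ
  ¬¬g▷g   : ¬ᵗ (¬ᵗ g)   ▷ g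
  g∧g▷g   : g ∧ᵗ g      ▷ g
  g∨g▷g   : g ∨ᵗ g      ▷ g
  g∧¬1▷¬1 : g ∧ᵗ ¬ᵗ 1ᵗ  ▷ ¬ᵗ 1ᵗ
  ¬1∧g▷¬1 : ¬ᵗ 1ᵗ ∧ᵗ g  ▷ ¬ᵗ 1ᵗ
  g∨1▷1   : g ∨ᵗ 1ᵗ     ▷ 1ᵗ
  1∨g▷1   : 1ᵗ ∨ᵗ g     ▷ 1ᵗ
  g∧1▷g   : g ∧ᵗ 1ᵗ     ▷ g
  1∧g▷g   : 1ᵗ ∧ᵗ g     ▷ g
  g∨¬1▷g  : g ∨ᵗ ¬ᵗ 1ᵗ  ▷ g
  ¬1∨g▷g  : ¬ᵗ 1ᵗ ∨ᵗ g  ▷ g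
  g∧¬g▷¬1 : g ∧ᵗ ¬ᵗ g   ▷ ¬ᵗ 1ᵗ
  ¬g∧g▷¬1 : ¬ᵗ g ∧ᵗ g   ▷ ¬ᵗ 1ᵗ
  g∨¬g▷1  : g ∨ᵗ ¬ᵗ g   ▷ 1ᵗ
  ¬g∨g▷1  : ¬ᵗ g ∨ᵗ g   ▷ 1ᵗ

data Label (n : ℕ) : Set where
  symbol : Symbol → Label n
  input  : Fin n → Label n

arity : ∀ {n} → Label n → ℕ
arity (symbol s) = symbolArity s
arity (input _)  = 0

-- Finiteness is imposed on circuits only; every other hypergraph below
-- is derived from circuits and terms by finite constructions.

record Hypergraph (n : ℕ) : Set₁ where
  field
    V   : Set
    E   : Set
    lab : E → Label n
    att : (e : E) → Vec V (suc (arity (lab e)))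

  res : E → V
  res e = head (att e)

  args : (e : E) → Vec V (arity (lab e))
  args e = tail (att e)

  Arc : Rel V 0ℓ
  Arc u w = ∃ λ e → res e ≡ u × w ∈ args e

  Path : Rel V 0ℓ
  Path = Star Arc

open Hypergraph public

-- Attachment strings are compared as lists because their lengths agree
-- only up to lab-≡.

record Morphism {n : ℕ} (G H : Hypergraph n) : Set where
  field
    vmap  : V G → V H
    emap  : E G → E H
    lab-≡ : ∀ e → lab H (emap e) ≡ lab G e
    att-≡ : ∀ e → toList (att H (emap e)) ≡ toList (Vec.map vmap (att G e))

open Morphism public

IsInjective : ∀ {n} {G H : Hypergraph n} → Morphism G H → Set
IsInjective f = Injective _≡_ _≡_ (vmap f) × Injective _≡_ _≡_ (emap f)

IsBijective : ∀ {n} {G H : Hypergraph n} → Morphism G H → Set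
IsBijective f = Bijective _≡_ _≡_ (vmap f) × Bijective _≡_ _≡_ (emap f)

-- Reachability proofs are irrelevant, so that a node reachable along several paths occurs once.

infix 9 _[_]ᴴ

_[_]ᴴ : ∀ {n} (G : Hypergraph n) → V G → Hypergraph n
G [ v ]ᴴ = record
  { V   = [ u ∈ V G ∣ Path G v u ]
  ; E   = [ e ∈ E G ∣ Path G v (res G e) ]
  ; lab = lab G ∘ value
  ; att = λ (e , r) →
      (res G e , r) ∷
      tabulate λ i → lookup (args G e) i ,
        Irr.map (λ v↠e → v↠e ◅◅ (e , refl , ∈-lookup i (args G e)) ◅ ε) r
  }

infixl 8 _∖_

_∖_ : ∀ {n} (G : Hypergraph n) → E G → Hypergraph n
G ∖ e = record
  { V   = V G
  ; E   = [ e′ ∈ E G ∣ e′ ≢ e ]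
  ; lab = lab G ∘ value
  ; att = att G ∘ value
  }

infixr 7 _⊎ᴴ_

_⊎ᴴ_ : ∀ {n} → Hypergraph n → Hypergraph n → Hypergraph n
G ⊎ᴴ H = record
  { V   = V G ⊎ V H
  ; E   = E G ⊎ E H
  ; lab = λ { (inj₁ e) → lab G e ; (inj₂ e) → lab H e }
  ; att = λ { (inj₁ e) → Vec.map inj₁ (att G e)
            ; (inj₂ e) → Vec.map inj₂ (att H e) }
  }

-- q exhibits K as the result of identifying ~-related vertices of U.

record IsQuotient {n : ℕ} {U K : Hypergraph n} (_~_ : Rel (V U) 0ℓ)
                  (q : Morphism U K) : Set where
  field
    vmap-surjective : Surjective _≡_ _≡_ (vmap q)
    vmap-kernel     : ∀ x y → vmap q x ≡ vmap q y ⇔ EqClosure _~_ x y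
    emap-bijective  : Bijective _≡_ _≡_ (emap q)

Finite : Set → Set
Finite A = ∃ λ k → A ↔ Fin k

record Circuit (n : ℕ) : Set₁ where
  field
    graph      : Hypergraph n
    V-finite   : Finite (V graph)
    E-finite   : Finite (E graph)
    root       : V graph
    reachable  : ∀ v → Path graph root v
    acyclic    : ∀ v → ¬ TransClosure (Arc graph) v v
    uniqueEdge : ∀ v → ∃! _≡_ λ e → res graph e ≡ v

open Circuit public

module _ {n : ℕ} where

  record _≅_ (C D : Circuit n) : Set where
    field
      morphism  : Morphism (graph C) (graph D)
      bijective : IsBijective morphism

  Arc-wellFounded : (C : Circuit n) → WellFounded (flip (Arc (graph C)))
  Arc-wellFounded C =
    Subrelation.wellFounded toFin-mono (On.wellFounded to (spo-wellFounded isSPO))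
    where
    open Inverse (proj₂ (V-finite C)) using (to; from; strictlyInverseʳ)

    _⊏_ : Rel (Fin (proj₁ (V-finite C))) 0ℓ
    i ⊏ j = TransClosure (Arc (graph C)) (from j) (from i)

    isSPO : IsStrictPartialOrder _≡_ _⊏_
    isSPO = record
      { isEquivalence = isEquivalence
      ; irrefl        = λ { refl → acyclic C _ }
      ; trans         = λ i⊏j j⊏k → j⊏k ++ i⊏j
      ; <-resp-≈      = resp₂ _⊏_
      }

    toFin-mono : ∀ {u w} → flip (Arc (graph C)) u w → to u ⊏ to w
    toFin-mono {u} {w} w→u =
      subst₂ (TransClosure (Arc (graph C)))
        (sym (strictlyInverseʳ w)) (sym (strictlyInverseʳ u)) [ w→u ]

  applyLabel : (l : Label n) → Vec (Term (Fin n)) (arity l) → Term (Fin n)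
  applyLabel (symbol s) ts = op s ts
  applyLabel (input i)  _  = var i

  module _ (C : Circuit n) where

    private G = graph C

    termAcc : ∀ v → Acc (flip (Arc G)) v → Term (Fin n)
    termAcc v (acc rec) with uniqueEdge C v
    ... | e , res≡v , _ = applyLabel (lab G e) (tabulate λ i →
      termAcc (lookup (args G e) i) (rec (e , res≡v , ∈-lookup i (args G e))))

    termAt : V G → Term (Fin n)
    termAt v = termAcc v (Arc-wellFounded C v)

    term : Term (Fin n)
    term = termAt (root C)

    termAcc-irrelevant : ∀ v (a b : Acc (flip (Arc G)) v) → termAcc v a ≡ termAcc v b
    termAcc-irrelevant v (acc r) (acc s) with uniqueEdge C v
    ... | e , res≡v , _ = cong (applyLabel (lab G e)) (tabulate-cong λ i →
      termAcc-irrelevant (lookup (args G e) i) (r _) (s _))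

    termAt-res : ∀ e → termAt (res G e) ≡
                       applyLabel (lab G e) (Vec.map termAt (args G e))
    termAt-res e = go (Arc-wellFounded C (res G e))
      where
      go : (a : Acc (flip (Arc G)) (res G e)) →
           termAcc (res G e) a ≡ applyLabel (lab G e) (Vec.map termAt (args G e))
      go (acc rec) with uniqueEdge C (res G e)
      ... | e′ , p , unique with refl ← unique {e} refl =
        cong (applyLabel (lab G e)) (begin
          tabulate (λ i → termAcc (lookup (args G e) i) (rec _))
            ≡⟨ tabulate-cong (λ i → termAcc-irrelevant (lookup (args G e) i)
                 (rec (e , p , ∈-lookup i (args G e))) (Arc-wellFounded C (lookup (args G e) i))) ⟩
          tabulate (termAt ∘ lookup (args G e))
            ≡⟨ tabulate-∘ termAt (lookup (args G e)) ⟩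
          Vec.map termAt (tabulate (lookup (args G e)))
            ≡⟨ cong (Vec.map termAt) (tabulate∘lookup (args G e)) ⟩
          Vec.map termAt (args G e) ∎)
        where open ≡-Reasoning

  Bisimilar : Rel (Circuit n) 0ℓ
  Bisimilar C D = term C ≡ term D

data SymbolOcc : Pattern → Set where
  here  : ∀ {s ts} → SymbolOcc (op s ts)
  there : ∀ {s ts} i → SymbolOcc (lookup ts i) → SymbolOcc (op s ts)

data HasVar : Pattern → Set where
  here  : HasVar g
  there : ∀ {s ts} i → HasVar (lookup ts i) → HasVar (op s ts)

-- The open vertex γ exists only if g occurs in t, and is then unique
-- since the occurrence is irrelevant.

data ◇V (t : Pattern) : Set where
  node : SymbolOcc t → ◇V t
  γ    : .(HasVar t) → ◇V t

◇root : ∀ t → ◇V t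
◇root (var _)   = γ here
◇root (op _ _)  = node here

◇lift : ∀ {s ts} i → ◇V (lookup ts i) → ◇V (op s ts)
◇lift i (node o) = node (there i o)
◇lift i (γ h)    = γ (there i h)

◇symbol : ∀ {t} → SymbolOcc t → Symbol
◇symbol (here {s}) = s
◇symbol (there _ o) = ◇symbol o

◇att : ∀ {t} (o : SymbolOcc t) → Vec (◇V t) (suc (symbolArity (◇symbol o)))
◇att (here {ts = ts}) = node here ∷ tabulate λ i → ◇lift i (◇root (lookup ts i))
◇att (there i o)      = Vec.map (◇lift i) (◇att o)

◇ : ∀ {n} → Pattern → Hypergraph n
◇ t = record
  { V   = ◇V t
  ; E   = SymbolOcc t
  ; lab = symbol ∘ ◇symbol
  ; att = ◇att
  }

module _ {n : ℕ} where

  data Identified {G : Hypergraph n} (v : V G) {l r : Pattern}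
                  (p : Morphism (◇ l) (G [ v ]ᴴ)) : Rel (V G ⊎ ◇V r) 0ℓ where
    root≈ : Identified v p (inj₁ v) (inj₂ (◇root r))
    γ≈    : ∀ {h h′} → Identified v p (inj₁ (value (vmap p (γ h)))) (inj₂ (γ h′))

  record ProperStep (C D : Circuit n) : Set₁ where
    field
      {l r} : Pattern
      rule  : l ▷ r
      v     : V (graph C)
      p     : Morphism (◇ l) (graph C [ v ]ᴴ)
      p-root : value (vmap p (◇root l)) ≡ v

      e     : E (graph C)
      e-res : res (graph C) e ≡ v

      K         : Hypergraph n
      glue      : Morphism ((graph C ∖ e) ⊎ᴴ ◇ r) K
      glue-quot : IsQuotient (Identified {graph C} v {l} {r} p) glue

    rootᴷ : V K
    rootᴷ = vmap glue (inj₁ (root C))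

    field
      prune           : Morphism (graph D) (K [ rootᴷ ]ᴴ)
      prune-bijective : IsBijective prune
      prune-root      : value (vmap prune (root D)) ≡ rootᴷ

  CollapseStep : Rel (Circuit n) 0ℓ
  CollapseStep C D = ∃ λ (f : Morphism (graph C) (graph D)) →
    ¬ IsInjective f × vmap f (root C) ≡ root D

𝒮 : (n : ℕ) → Rel (Circuit n) (lsuc 0ℓ)
𝒮 n = ProperStep ∪ CollapseStep

𝒮′ : (n : ℕ) → Rel (Circuit n) (lsuc 0ℓ)
𝒮′ n = ProperStep

{-# OPTIONS --safe #-}
module Submission where

-- There is a weight of terms that every rule decreases.  A proper step contracts occurrences of a
-- redex in the term of a circuit, so it decreases the weight of that term; a collapse step preserves
-- the term and decreases the number of nodes.
--
-- For confluence, a bottom-up normal form nf of terms is invariant under the rules, hence nf (term C) is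
-- invariant under all steps.  The circuit whose nodes are the distinct subterms of t is the most
-- collapsed circuit with term t, and a redex of t is a redex of that circuit, since there equal
-- subterms share their node.  By alternating collapsing and contracting, every circuit reduces
-- to the collapsed circuit of its normal form.

open import Defs
open import Data.Nat.Base using (ℕ; zero; suc; _+_; _≤_; _<_; z≤n; s≤s; s≤s⁻¹)
open import Data.Nat.Induction using (<-wellFounded)
open import Data.Nat.Properties
open import Data.Fin.Base using (Fin; zero; suc; punchOut)
import Data.Fin.Properties as Fin
import Data.Irrelevant as Irr
open import Data.List.Base as List using (List)
open import Data.List.Membership.Propositional using (find; lose) renaming (_∈_ to _∈ᴸ_)
import Data.List.Membership.Propositional.Properties as List
import Data.List.Membership.DecPropositional as DecList
import Data.List.Properties as List
open import Data.List.Relation.Unary.All as All using ()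
open import Data.List.Relation.Unary.AllPairs.Core using (_∷_)
open import Data.List.Relation.Unary.Any as Any using ()
import Data.List.Relation.Unary.Any.Properties as Any
open import Data.List.Relation.Unary.Unique.Propositional using (Unique)
open import Data.List.Relation.Unary.Unique.DecPropositional.Properties using (deduplicate-!)
open import Data.Product.Base using (∃; ∃₂; _×_; _,_; proj₁; proj₂)
open import Data.Product using (∃!)
open import Data.Product.Relation.Binary.Lex.Strict using (×-Lex; ×-wellFounded)
open import Data.Refinement as Refinement using (Refinement-syntax; value; proof; _,_; value-injective)
open import Data.Sum.Base as Sum using (_⊎_; inj₁; inj₂)
import Data.Sum.Properties as Sum
open import Data.Unit.Base using (tt)
open import Data.Vec.Base as Vec using (Vec; []; _∷_; lookup; head; tail; toList; tabulate)
open import Data.Vec.Membership.Propositional using (_∈_)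
open import Data.Vec.Membership.Propositional.Properties using (∈-lookup; ∈-map⁺; ∈-tabulate⁺; ∈-toList⁺; ∈-toList⁻)
import Data.Vec.Properties as Vec
open import Data.Vec.Relation.Unary.Any using (index)
open import Data.Vec.Relation.Unary.Any.Properties using (lookup-index)
open import Function.Base using (_∘_; id; flip)
open import Function.Bundles using (_↔_; mk↔ₛ′; mk⇔; Equivalence; Inverse)
import Function.Construct.Composition as Composition
import Function.Construct.Symmetry as Symmetry
open import Function.Definitions using (Injective)
open import Function.Properties.Inverse using (↔-trans; ↔⇒↣)
open import Induction.WellFounded using (Acc; acc; WellFounded)
open import Level using (Level) renaming (suc to lsuc; zero to 0ℓ)
open import Relation.Binary.Core using (Rel)
import Relation.Binary.Construct.On as On
open import Relation.Binary.Construct.Closure.Equivalence as EqClosure using (EqClosure)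
open import Relation.Binary.Construct.Closure.ReflexiveTransitive as Star using (ε; _◅_; _◅◅_)
open import Relation.Binary.Construct.Closure.Symmetric using (fwd; bwd)
open import Relation.Binary.Construct.Closure.Transitive using (TransClosure; [_]; _∷_)
open import Relation.Binary.Definitions using (DecidableEquality)
open import Relation.Binary.PropositionalEquality
open import Relation.Binary.Structures using (IsEquivalence)
open import Relation.Nullary.Decidable using (Dec; yes; no; map′; _×-dec_; recompute)
open import Relation.Nullary.Negation using (¬_; contradiction; contradiction-irr)

-- The rules overlap with distinct contracta: `¬ 1 ∨ ¬ ¬ 1` contracts at its root to `¬ ¬ 1` and to
-- `1`. Since `nf` contracts only terms whose arguments are already normal, and no normal form is a
-- double negation, this conflict never arises inside `nf`, so its invariance is a finite check over
-- the rules. For the system without collapsing, the measure must depend on the term alone, because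
-- bisimilar circuits may differ in size; a single contracted node then stands for many occurrences
-- at once. A rule with right-hand side `g` merges the contracted node with the node matched by `g`.
-- A node of the new circuit may thus correspond to two old nodes with different terms, so the
-- circuits are compared by a relation between nodes and an inequality between their terms rather
-- than by a map of nodes.

-- Weights of terms

-- 0 must outweigh ¬ 1 because of the rule 0 → ¬ 1.

symbolWeight : Symbol → ℕ
symbolWeight 0ˢ = 3
symbolWeight _  = 1

module _ {X : Set} where

  mutual
    inst : Pattern → Term X → Term X
    inst (var _)   t = t
    inst (op s ps) t = op s (insts ps t)

    insts : ∀ {k} → Vec Pattern k → Term X → Vec (Term X) k
    insts []       t = []
    insts (p ∷ ps) t = inst p t ∷ insts ps t

  lookup-insts : ∀ {k} (ps : Vec Pattern k) t i → lookup (insts ps t) i ≡ inst (lookup ps i) t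
  lookup-insts (p ∷ ps) t zero    = refl
  lookup-insts (p ∷ ps) t (suc i) = lookup-insts ps t i

  mutual
    weight : Term X → ℕ
    weight (var _)   = 1
    weight (op s ts) = symbolWeight s + weights ts

    weights : ∀ {k} → Vec (Term X) k → ℕ
    weights []       = 0
    weights (t ∷ ts) = weight t + weights ts

  weight-positive : ∀ t → 1 ≤ weight t
  weight-positive (var _)  = s≤s z≤n
  weight-positive (_ ∧ᵗ _) = s≤s z≤n
  weight-positive (_ ∨ᵗ _) = s≤s z≤n
  weight-positive (¬ᵗ _)   = s≤s z≤n
  weight-positive 0ᵗ       = s≤s z≤n
  weight-positive 1ᵗ       = s≤s z≤n

  lookup-weights : ∀ {k} (ts : Vec (Term X) k) i → weight (lookup ts i) ≤ weights ts
  lookup-weights (t ∷ ts) zero    = m≤m+n _ _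
  lookup-weights (t ∷ ts) (suc i) = ≤-trans (lookup-weights ts i) (m≤n+m _ _)

  weights-< : ∀ s (ts : Vec (Term X) (symbolArity s)) → weights ts < weight (op s ts)
  weights-< ∧ˢ _  = ≤-refl
  weights-< ∨ˢ _  = ≤-refl
  weights-< ¬ˢ _  = ≤-refl
  weights-< 0ˢ [] = s≤s z≤n
  weights-< 1ˢ _  = ≤-refl

  weights-mono-≤ : ∀ {k} (ss ts : Vec (Term X) k) →
                   (∀ i → weight (lookup ss i) ≤ weight (lookup ts i)) → weights ss ≤ weights ts
  weights-mono-≤ []       []       _ = z≤n
  weights-mono-≤ (_ ∷ ss) (_ ∷ ts) h = +-mono-≤ (h zero) (weights-mono-≤ ss ts λ i → h (suc i))

  weights-mono-< : ∀ {k} (ss ts : Vec (Term X) k) →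
                   (∀ i → weight (lookup ss i) ≤ weight (lookup ts i)) →
                   (j : Fin k) → weight (lookup ss j) < weight (lookup ts j) → weights ss < weights ts
  weights-mono-< (_ ∷ ss) (_ ∷ ts) h zero    lt = +-mono-<-≤ lt (weights-mono-≤ ss ts λ i → h (suc i))
  weights-mono-< (_ ∷ ss) (_ ∷ ts) h (suc j) lt =
    +-mono-≤-< (h zero) (weights-mono-< ss ts (λ i → h (suc i)) j lt)

  -- No rule duplicates `g`, and all rules but three have fewer symbols on the right. The rule for
  -- `0` relies on its larger weight; `g∧¬g▷¬1` and its mirror image keep two symbols, and there the
  -- weight of the discarded `g` makes the decrease strict.
  rule-weight : ∀ {l r} → l ▷ r → ∀ t → weight (inst r t) < weight (inst l t)
  rule-weight 0▷¬1    t = s≤s (s≤s (s≤s z≤n))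
  rule-weight ¬¬g▷g   t = s≤s (≤-trans (m≤m+n _ 0) (≤-trans (n≤1+n _) (m≤m+n _ 0)))
  rule-weight g∧g▷g   t = s≤s (m≤m+n _ _)
  rule-weight g∨g▷g   t = s≤s (m≤m+n _ _)
  rule-weight g∧¬1▷¬1 t = s≤s (m≤n+m _ _)
  rule-weight ¬1∧g▷¬1 t = s≤s (s≤s (s≤s z≤n))
  rule-weight g∨1▷1   t = s≤s (m≤n+m _ _)
  rule-weight 1∨g▷1   t = s≤s (s≤s z≤n)
  rule-weight g∧1▷g   t = s≤s (m≤m+n _ _)
  rule-weight 1∧g▷g   t = s≤s (≤-trans (m≤m+n _ 0) (n≤1+n _))
  rule-weight g∨¬1▷g  t = s≤s (m≤m+n _ _)
  rule-weight ¬1∨g▷g  t = s≤s (≤-trans (m≤m+n _ 0) (m≤n+m _ 2))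
  rule-weight g∧¬g▷¬1 t = s≤s (+-mono-≤ (weight-positive t) (s≤s z≤n))
  rule-weight ¬g∧g▷¬1 t = s≤s (s≤s (≤-trans (weight-positive t) (≤-trans (m≤m+n _ 0) (m≤m+n _ _))))
  rule-weight g∨¬g▷1  t = s≤s (≤-trans (weight-positive t) (m≤m+n _ _))
  rule-weight ¬g∨g▷1  t = s≤s (s≤s z≤n)

  -- Overlaps of rules at the root

  NotDoubleNegation : Term X → Set
  NotDoubleNegation t = ∀ u → t ≢ ¬ᵗ (¬ᵗ u)

  -- The two terms on which overlapping rules have distinct contracta, namely 1 and ¬ ¬ 1.

  Ambiguous : Term X → Set
  Ambiguous t = t ≡ ¬ᵗ 1ᵗ ∨ᵗ ¬ᵗ (¬ᵗ 1ᵗ) ⊎ t ≡ ¬ᵗ (¬ᵗ 1ᵗ) ∨ᵗ ¬ᵗ 1ᵗ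

  ∨-unambiguous : ∀ {s t} → NotDoubleNegation s → NotDoubleNegation t → ¬ Ambiguous (s ∨ᵗ t)
  ∨-unambiguous _  ht (inj₁ refl) = ht _ refl
  ∨-unambiguous hs _  (inj₂ refl) = hs _ refl

  -- Unifying two left-hand sides makes the contracta syntactically equal, except when `¬ 1` is
  -- dropped from a disjunction that is also complementary. The pairs not listed have no common
  -- instance: `g ∧ g` and `g ∧ ¬ g`, for example, would force a term to equal its own negation.
  contractum-unique : ∀ {l r l′ r′ t t′} → l ▷ r → l′ ▷ r′ → ¬ Ambiguous (inst l t) →
                      inst l t ≡ inst l′ t′ → inst r t ≡ inst r′ t′
  contractum-unique 0▷¬1     0▷¬1     _     refl = refl
  contractum-unique ¬¬g▷g    ¬¬g▷g    _     refl = refl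
  contractum-unique g∧g▷g    g∧g▷g    _     refl = refl
  contractum-unique g∧g▷g    g∧¬1▷¬1  _     refl = refl
  contractum-unique g∧g▷g    ¬1∧g▷¬1  _     refl = refl
  contractum-unique g∧g▷g    g∧1▷g    _     refl = refl
  contractum-unique g∧g▷g    1∧g▷g    _     refl = refl
  contractum-unique g∧¬1▷¬1  g∧g▷g    _     refl = refl
  contractum-unique g∧¬1▷¬1  g∧¬1▷¬1  _     refl = refl
  contractum-unique g∧¬1▷¬1  ¬1∧g▷¬1  _     refl = refl
  contractum-unique g∧¬1▷¬1  1∧g▷g    _     refl = refl
  contractum-unique g∧¬1▷¬1  g∧¬g▷¬1  _     refl = refl
  contractum-unique g∧¬1▷¬1  ¬g∧g▷¬1  _     refl = refl
  contractum-unique ¬1∧g▷¬1  g∧g▷g    _     refl = refl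
  contractum-unique ¬1∧g▷¬1  g∧¬1▷¬1  _     refl = refl
  contractum-unique ¬1∧g▷¬1  ¬1∧g▷¬1  _     refl = refl
  contractum-unique ¬1∧g▷¬1  g∧1▷g    _     refl = refl
  contractum-unique ¬1∧g▷¬1  g∧¬g▷¬1  _     refl = refl
  contractum-unique ¬1∧g▷¬1  ¬g∧g▷¬1  _     refl = refl
  contractum-unique g∧1▷g    g∧g▷g    _     refl = refl
  contractum-unique g∧1▷g    ¬1∧g▷¬1  _     refl = refl
  contractum-unique g∧1▷g    g∧1▷g    _     refl = refl
  contractum-unique g∧1▷g    1∧g▷g    _     refl = refl
  contractum-unique g∧1▷g    ¬g∧g▷¬1  _     refl = refl
  contractum-unique 1∧g▷g    g∧g▷g    _     refl = refl
  contractum-unique 1∧g▷g    g∧¬1▷¬1  _     refl = refl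
  contractum-unique 1∧g▷g    g∧1▷g    _     refl = refl
  contractum-unique 1∧g▷g    1∧g▷g    _     refl = refl
  contractum-unique 1∧g▷g    g∧¬g▷¬1  _     refl = refl
  contractum-unique g∧¬g▷¬1  g∧¬1▷¬1  _     refl = refl
  contractum-unique g∧¬g▷¬1  ¬1∧g▷¬1  _     refl = refl
  contractum-unique g∧¬g▷¬1  1∧g▷g    _     refl = refl
  contractum-unique g∧¬g▷¬1  g∧¬g▷¬1  _     refl = refl
  contractum-unique ¬g∧g▷¬1  g∧¬1▷¬1  _     refl = refl
  contractum-unique ¬g∧g▷¬1  ¬1∧g▷¬1  _     refl = refl
  contractum-unique ¬g∧g▷¬1  g∧1▷g    _     refl = refl
  contractum-unique ¬g∧g▷¬1  ¬g∧g▷¬1  _     refl = refl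
  contractum-unique g∨g▷g    g∨g▷g    _     refl = refl
  contractum-unique g∨g▷g    g∨1▷1    _     refl = refl
  contractum-unique g∨g▷g    1∨g▷1    _     refl = refl
  contractum-unique g∨g▷g    g∨¬1▷g   _     refl = refl
  contractum-unique g∨g▷g    ¬1∨g▷g   _     refl = refl
  contractum-unique g∨1▷1    g∨g▷g    _     refl = refl
  contractum-unique g∨1▷1    g∨1▷1    _     refl = refl
  contractum-unique g∨1▷1    1∨g▷1    _     refl = refl
  contractum-unique g∨1▷1    ¬1∨g▷g   _     refl = refl
  contractum-unique g∨1▷1    ¬g∨g▷1   _     refl = refl
  contractum-unique 1∨g▷1    g∨g▷g    _     refl = refl
  contractum-unique 1∨g▷1    g∨1▷1    _     refl = refl
  contractum-unique 1∨g▷1    1∨g▷1    _     refl = refl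
  contractum-unique 1∨g▷1    g∨¬1▷g   _     refl = refl
  contractum-unique 1∨g▷1    g∨¬g▷1   _     refl = refl
  contractum-unique g∨¬1▷g   g∨g▷g    _     refl = refl
  contractum-unique g∨¬1▷g   1∨g▷1    _     refl = refl
  contractum-unique g∨¬1▷g   g∨¬1▷g   _     refl = refl
  contractum-unique g∨¬1▷g   ¬1∨g▷g   _     refl = refl
  contractum-unique g∨¬1▷g   g∨¬g▷1   _     refl = refl
  contractum-unique g∨¬1▷g   ¬g∨g▷1   clear refl = contradiction (inj₂ refl) clear
  contractum-unique ¬1∨g▷g   g∨g▷g    _     refl = refl
  contractum-unique ¬1∨g▷g   g∨1▷1    _     refl = refl
  contractum-unique ¬1∨g▷g   g∨¬1▷g   _     refl = refl
  contractum-unique ¬1∨g▷g   ¬1∨g▷g   _     refl = refl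
  contractum-unique ¬1∨g▷g   g∨¬g▷1   clear refl = contradiction (inj₁ refl) clear
  contractum-unique ¬1∨g▷g   ¬g∨g▷1   _     refl = refl
  contractum-unique g∨¬g▷1   1∨g▷1    _     refl = refl
  contractum-unique g∨¬g▷1   g∨¬1▷g   _     refl = refl
  contractum-unique g∨¬g▷1   ¬1∨g▷g   clear refl = contradiction (inj₁ refl) clear
  contractum-unique g∨¬g▷1   g∨¬g▷1   _     refl = refl
  contractum-unique ¬g∨g▷1   g∨1▷1    _     refl = refl
  contractum-unique ¬g∨g▷1   g∨¬1▷g   clear refl = contradiction (inj₂ refl) clear
  contractum-unique ¬g∨g▷1   ¬1∨g▷g   _     refl = refl
  contractum-unique ¬g∨g▷1   ¬g∨g▷1   _     refl = refl

-- Bottom-up normal forms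

infix 4 _≟ˢ_

_≟ˢ_ : DecidableEquality Symbol
s ≟ˢ t = map′ (λ eq → trans (sym (decode-code s)) (trans (cong decode eq) (decode-code t)))
              (cong code) (code s ≟ code t)
  where
  code : Symbol → ℕ
  code ∧ˢ = 0
  code ∨ˢ = 1
  code ¬ˢ = 2
  code 0ˢ = 3
  code 1ˢ = 4

  decode : ℕ → Symbol
  decode 0 = ∧ˢ
  decode 1 = ∨ˢ
  decode 2 = ¬ˢ
  decode 3 = 0ˢ
  decode _ = 1ˢ

  decode-code : ∀ s → decode (code s) ≡ s
  decode-code ∧ˢ = refl
  decode-code ∨ˢ = refl
  decode-code ¬ˢ = refl
  decode-code 0ˢ = refl
  decode-code 1ˢ = refl

module Normalisation {X : Set} (_≟ˣ_ : DecidableEquality X) where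

  infix 4 _≟ᵗ_ _≟ᵗˢ_

  mutual
    _≟ᵗ_ : DecidableEquality (Term X)
    var x   ≟ᵗ var y   = map′ (cong var) (λ { refl → refl }) (x ≟ˣ y)
    var _   ≟ᵗ op _ _  = no λ ()
    op _ _  ≟ᵗ var _   = no λ ()
    op s ss ≟ᵗ op t ts with s ≟ˢ t
    ... | no s≢t   = no λ { refl → s≢t refl }
    ... | yes refl = map′ (cong (op s)) (λ { refl → refl }) (ss ≟ᵗˢ ts)

    _≟ᵗˢ_ : ∀ {k} → DecidableEquality (Vec (Term X) k)
    []       ≟ᵗˢ []       = yes refl
    (s ∷ ss) ≟ᵗˢ (t ∷ ts) =
      map′ (λ (p , q) → cong₂ _∷_ p q) (λ { refl → refl , refl }) (s ≟ᵗ t ×-dec ss ≟ᵗˢ ts)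

  RootRedex : Term X → Set
  RootRedex t = ∃₂ λ l r → l ▷ r × ∃ λ u → t ≡ inst l u

  rootRedex? : ∀ t → Dec (RootRedex t)
  rootRedex? (var _) = no λ { (_ , _ , 0▷¬1 , _ , ()) }
  rootRedex? 0ᵗ      = yes (_ , _ , 0▷¬1 , 1ᵗ , refl)
  rootRedex? 1ᵗ      = no λ { (_ , _ , 0▷¬1 , _ , ()) }
  rootRedex? (¬ᵗ (¬ᵗ t))   = yes (_ , _ , ¬¬g▷g , t , refl)
  rootRedex? (¬ᵗ (var _))  = no λ { (_ , _ , 0▷¬1 , _ , ()) }
  rootRedex? (¬ᵗ (_ ∧ᵗ _)) = no λ { (_ , _ , 0▷¬1 , _ , ()) }
  rootRedex? (¬ᵗ (_ ∨ᵗ _)) = no λ { (_ , _ , 0▷¬1 , _ , ()) }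
  rootRedex? (¬ᵗ 0ᵗ)       = no λ { (_ , _ , 0▷¬1 , _ , ()) }
  rootRedex? (¬ᵗ 1ᵗ)       = no λ { (_ , _ , 0▷¬1 , _ , ()) }
  rootRedex? (s ∧ᵗ t)
    with s ≟ᵗ t | t ≟ᵗ ¬ᵗ 1ᵗ | s ≟ᵗ ¬ᵗ 1ᵗ | t ≟ᵗ 1ᵗ | s ≟ᵗ 1ᵗ | t ≟ᵗ ¬ᵗ s | s ≟ᵗ ¬ᵗ t
  ... | yes refl | _ | _ | _ | _ | _ | _ = yes (_ , _ , g∧g▷g , s , refl)
  ... | _ | yes refl | _ | _ | _ | _ | _ = yes (_ , _ , g∧¬1▷¬1 , s , refl)
  ... | _ | _ | yes refl | _ | _ | _ | _ = yes (_ , _ , ¬1∧g▷¬1 , t , refl)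
  ... | _ | _ | _ | yes refl | _ | _ | _ = yes (_ , _ , g∧1▷g , s , refl)
  ... | _ | _ | _ | _ | yes refl | _ | _ = yes (_ , _ , 1∧g▷g , t , refl)
  ... | _ | _ | _ | _ | _ | yes refl | _ = yes (_ , _ , g∧¬g▷¬1 , s , refl)
  ... | _ | _ | _ | _ | _ | _ | yes refl = yes (_ , _ , ¬g∧g▷¬1 , t , refl)
  ... | no n₁ | no n₂ | no n₃ | no n₄ | no n₅ | no n₆ | no n₇ = no λ
    { (_ , _ , g∧g▷g   , _ , refl) → n₁ refl
    ; (_ , _ , g∧¬1▷¬1 , _ , refl) → n₂ refl
    ; (_ , _ , ¬1∧g▷¬1 , _ , refl) → n₃ refl
    ; (_ , _ , g∧1▷g   , _ , refl) → n₄ refl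
    ; (_ , _ , 1∧g▷g   , _ , refl) → n₅ refl
    ; (_ , _ , g∧¬g▷¬1 , _ , refl) → n₆ refl
    ; (_ , _ , ¬g∧g▷¬1 , _ , refl) → n₇ refl }
  rootRedex? (s ∨ᵗ t)
    with s ≟ᵗ t | t ≟ᵗ 1ᵗ | s ≟ᵗ 1ᵗ | t ≟ᵗ ¬ᵗ 1ᵗ | s ≟ᵗ ¬ᵗ 1ᵗ | t ≟ᵗ ¬ᵗ s | s ≟ᵗ ¬ᵗ t
  ... | yes refl | _ | _ | _ | _ | _ | _ = yes (_ , _ , g∨g▷g , s , refl)
  ... | _ | yes refl | _ | _ | _ | _ | _ = yes (_ , _ , g∨1▷1 , s , refl)
  ... | _ | _ | yes refl | _ | _ | _ | _ = yes (_ , _ , 1∨g▷1 , t , refl)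
  ... | _ | _ | _ | yes refl | _ | _ | _ = yes (_ , _ , g∨¬1▷g , s , refl)
  ... | _ | _ | _ | _ | yes refl | _ | _ = yes (_ , _ , ¬1∨g▷g , t , refl)
  ... | _ | _ | _ | _ | _ | yes refl | _ = yes (_ , _ , g∨¬g▷1 , s , refl)
  ... | _ | _ | _ | _ | _ | _ | yes refl = yes (_ , _ , ¬g∨g▷1 , t , refl)
  ... | no n₁ | no n₂ | no n₃ | no n₄ | no n₅ | no n₆ | no n₇ = no λ
    { (_ , _ , g∨g▷g   , _ , refl) → n₁ refl
    ; (_ , _ , g∨1▷1   , _ , refl) → n₂ refl
    ; (_ , _ , 1∨g▷1   , _ , refl) → n₃ refl
    ; (_ , _ , g∨¬1▷g  , _ , refl) → n₄ refl
    ; (_ , _ , ¬1∨g▷g  , _ , refl) → n₅ refl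
    ; (_ , _ , g∨¬g▷1  , _ , refl) → n₆ refl
    ; (_ , _ , ¬g∨g▷1  , _ , refl) → n₇ refl }

  contract : Term X → Term X
  contract t with rootRedex? t
  ... | yes (_ , r , _ , u , _) = inst r u
  ... | no _                    = t

  contract-rule : ∀ {l r} → l ▷ r → ∀ u → ¬ Ambiguous (inst l u) → contract (inst l u) ≡ inst r u
  contract-rule {l} rule u clear with rootRedex? (inst l u)
  ... | yes (_ , _ , rule′ , _ , eq) = sym (contractum-unique rule rule′ clear eq)
  ... | no ¬redex                    = contradiction (_ , _ , rule , u , refl) ¬redex

  contract-¬redex : ∀ {t} → ¬ RootRedex t → contract t ≡ t
  contract-¬redex {t} ¬redex with rootRedex? t
  ... | yes redex = contradiction redex ¬redex
  ... | no _      = refl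

  mutual
    -- One contraction per symbol is enough: each right-hand side is `g`, `1` or `¬ 1`, so
    -- contracting a term with normal arguments gives a normal term at once.
    nf : Term X → Term X
    nf (var x)   = var x
    nf (op s ts) = contract (op s (nfs ts))

    nfs : ∀ {k} → Vec (Term X) k → Vec (Term X) k
    nfs []       = []
    nfs (t ∷ ts) = nf t ∷ nfs ts

  contract-notDoubleNegation : ∀ s (ts : Vec (Term X) (symbolArity s)) →
                               (∀ i → NotDoubleNegation (lookup ts i)) →
                               NotDoubleNegation (contract (op s ts))
  contract-notDoubleNegation s ts h with rootRedex? (op s ts)
  ... | no ¬redex = λ { u refl → ¬redex (_ , _ , ¬¬g▷g , u , refl) }
  ... | yes (_ , _ , 0▷¬1    , _ , refl) = λ _ ()
  ... | yes (_ , _ , ¬¬g▷g   , _ , refl) = λ { u refl → h zero (¬ᵗ u) refl }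
  ... | yes (_ , _ , g∧g▷g   , _ , refl) = h zero
  ... | yes (_ , _ , g∨g▷g   , _ , refl) = h zero
  ... | yes (_ , _ , g∧¬1▷¬1 , _ , refl) = λ _ ()
  ... | yes (_ , _ , ¬1∧g▷¬1 , _ , refl) = λ _ ()
  ... | yes (_ , _ , g∨1▷1   , _ , refl) = λ _ ()
  ... | yes (_ , _ , 1∨g▷1   , _ , refl) = λ _ ()
  ... | yes (_ , _ , g∧1▷g   , _ , refl) = h zero
  ... | yes (_ , _ , 1∧g▷g   , _ , refl) = h (suc zero)
  ... | yes (_ , _ , g∨¬1▷g  , _ , refl) = h zero
  ... | yes (_ , _ , ¬1∨g▷g  , _ , refl) = h (suc zero)
  ... | yes (_ , _ , g∧¬g▷¬1 , _ , refl) = λ _ ()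
  ... | yes (_ , _ , ¬g∧g▷¬1 , _ , refl) = λ _ ()
  ... | yes (_ , _ , g∨¬g▷1  , _ , refl) = λ _ ()
  ... | yes (_ , _ , ¬g∨g▷1  , _ , refl) = λ _ ()

  mutual
    -- This keeps `nf` away from the ambiguous terms, each of which has the argument `¬ ¬ 1`.
    nf-notDoubleNegation : ∀ t → NotDoubleNegation (nf t)
    nf-notDoubleNegation (var _)   = λ _ ()
    nf-notDoubleNegation (op s ts) =
      contract-notDoubleNegation s (nfs ts) (nfs-notDoubleNegation ts)

    nfs-notDoubleNegation : ∀ {k} (ts : Vec (Term X) k) i → NotDoubleNegation (lookup (nfs ts) i)
    nfs-notDoubleNegation (t ∷ ts) zero    = nf-notDoubleNegation t
    nfs-notDoubleNegation (t ∷ ts) (suc i) = nfs-notDoubleNegation ts i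

  -- `contract (¬ᵗ t)` does not compute before the head of `t` is known; the second constructor
  -- therefore carries its value.
  data NegationView (t : Term X) : Set where
    negation    : ∀ u → t ≡ ¬ᵗ u → NegationView t
    nonNegation : (∀ u → t ≢ ¬ᵗ u) → contract (¬ᵗ t) ≡ ¬ᵗ t → NegationView t

  negationView : ∀ t → NegationView t
  negationView (¬ᵗ t)   = negation t refl
  negationView (var _)  = nonNegation (λ _ ()) refl
  negationView (_ ∧ᵗ _) = nonNegation (λ _ ()) refl
  negationView (_ ∨ᵗ _) = nonNegation (λ _ ()) refl
  negationView 0ᵗ       = nonNegation (λ _ ()) refl
  negationView 1ᵗ       = nonNegation (λ _ ()) refl

  contract-¬¬ : ∀ t → NotDoubleNegation t → contract (¬ᵗ contract (¬ᵗ t)) ≡ t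
  contract-¬¬ t h with negationView t
  ... | nonNegation _ eq rewrite eq = refl
  ... | negation u refl with negationView u
  ...   | nonNegation _ eq = eq
  ...   | negation w refl  = contradiction refl (h w)

  -- The contraction of ¬ t is ¬ t or, if t is ¬ u, it is u: a complementary pair in either case.

  complement-elim : (P : Term X → Term X → Set) →
                    (∀ u → NotDoubleNegation u → NotDoubleNegation (¬ᵗ u) → P u (¬ᵗ u)) →
                    (∀ u → NotDoubleNegation (¬ᵗ u) → NotDoubleNegation u → P (¬ᵗ u) u) →
                    ∀ t → NotDoubleNegation t → P t (contract (¬ᵗ t))
  complement-elim P right left t h with negationView t
  ... | nonNegation n eq rewrite eq = right t h λ { u refl → n u refl }
  ... | negation u refl = left u h λ { w refl → h (¬ᵗ w) refl }

  -- Both sides unfold to contractions of patterns filled with the normal form `s`. Only an inner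
  -- `¬ g` causes trouble, since `contract (¬ᵗ s)` may strip a negation instead of adding one. The
  -- pair is complementary all the same, with its sides exchanged, and the mirrored rule applies.
  nf-rule : ∀ {l r} → l ▷ r → ∀ t → nf (inst l t) ≡ nf (inst r t)
  nf-rule rule t = go rule
    where
    s = nf t
    h = nf-notDoubleNegation t

    go : ∀ {l r} → l ▷ r → nf (inst l t) ≡ nf (inst r t)
    go 0▷¬1    = refl
    go ¬¬g▷g   = contract-¬¬ s h
    go g∧g▷g   = contract-rule g∧g▷g   s λ { (inj₁ ()) ; (inj₂ ()) }
    go g∨g▷g   = contract-rule g∨g▷g   s (∨-unambiguous h h)
    go g∧¬1▷¬1 = contract-rule g∧¬1▷¬1 s λ { (inj₁ ()) ; (inj₂ ()) }
    go ¬1∧g▷¬1 = contract-rule ¬1∧g▷¬1 s λ { (inj₁ ()) ; (inj₂ ()) }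
    go g∨1▷1   = contract-rule g∨1▷1   s λ { (inj₁ ()) ; (inj₂ ()) }
    go 1∨g▷1   = contract-rule 1∨g▷1   s λ { (inj₁ ()) ; (inj₂ ()) }
    go g∧1▷g   = contract-rule g∧1▷g   s λ { (inj₁ ()) ; (inj₂ ()) }
    go 1∧g▷g   = contract-rule 1∧g▷g   s λ { (inj₁ ()) ; (inj₂ ()) }
    go g∨¬1▷g  = contract-rule g∨¬1▷g  s (∨-unambiguous h λ _ ())
    go ¬1∨g▷g  = contract-rule ¬1∨g▷g  s (∨-unambiguous (λ _ ()) h)
    go g∧¬g▷¬1 = complement-elim (λ a b → contract (a ∧ᵗ b) ≡ ¬ᵗ 1ᵗ)
      (λ u _ _ → contract-rule g∧¬g▷¬1 u λ { (inj₁ ()) ; (inj₂ ()) })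
      (λ u _ _ → contract-rule ¬g∧g▷¬1 u λ { (inj₁ ()) ; (inj₂ ()) }) s h
    go ¬g∧g▷¬1 = complement-elim (λ a b → contract (b ∧ᵗ a) ≡ ¬ᵗ 1ᵗ)
      (λ u _ _ → contract-rule ¬g∧g▷¬1 u λ { (inj₁ ()) ; (inj₂ ()) })
      (λ u _ _ → contract-rule g∧¬g▷¬1 u λ { (inj₁ ()) ; (inj₂ ()) }) s h
    go g∨¬g▷1  = complement-elim (λ a b → contract (a ∨ᵗ b) ≡ 1ᵗ)
      (λ u p q → contract-rule g∨¬g▷1 u (∨-unambiguous p q))
      (λ u p q → contract-rule ¬g∨g▷1 u (∨-unambiguous p q)) s h
    go ¬g∨g▷1  = complement-elim (λ a b → contract (b ∨ᵗ a) ≡ 1ᵗ)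
      (λ u p q → contract-rule ¬g∨g▷1 u (∨-unambiguous q p))
      (λ u p q → contract-rule g∨¬g▷1 u (∨-unambiguous q p)) s h

  nfs-cong : ∀ {k} (ss ts : Vec (Term X) k) →
             (∀ i → nf (lookup ss i) ≡ nf (lookup ts i)) → nfs ss ≡ nfs ts
  nfs-cong []       []       _ = refl
  nfs-cong (_ ∷ ss) (_ ∷ ts) h = cong₂ _∷_ (h zero) (nfs-cong ss ts λ i → h (suc i))

  infix 4 _≼_ _≺_

  -- The normal form and the weight are bundled so that one induction over a proper step yields both
  -- the invariant for confluence and the bound for termination.
  record _≼_ (s t : Term X) : Set where
    constructor ⟨_,_⟩
    field
      ≼-nf     : nf s ≡ nf t
      ≼-weight : weight s ≤ weight t

  record _≺_ (s t : Term X) : Set where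
    constructor ⟨_,_⟩
    field
      ≺-nf     : nf s ≡ nf t
      ≺-weight : weight s < weight t

  open _≼_ public
  open _≺_ public

  ≼-refl : ∀ {t} → t ≼ t
  ≼-refl = ⟨ refl , ≤-refl ⟩

  ≼-≺-trans : ∀ {s t u} → s ≼ t → t ≺ u → s ≺ u
  ≼-≺-trans ⟨ p , q ⟩ ⟨ p′ , q′ ⟩ = ⟨ trans p p′ , ≤-<-trans q q′ ⟩

  ≺⇒≼ : ∀ {s t} → s ≺ t → s ≼ t
  ≺⇒≼ ⟨ p , q ⟩ = ⟨ p , <⇒≤ q ⟩

  rule-≺ : ∀ {l r} → l ▷ r → ∀ t → inst r t ≺ inst l t
  rule-≺ rule t = ⟨ sym (nf-rule rule t) , rule-weight rule t ⟩

  op-≼ : ∀ s (ts us : Vec (Term X) (symbolArity s)) →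
         (∀ i → lookup ts i ≼ lookup us i) → op s ts ≼ op s us
  op-≼ s ts us h = ⟨ cong (λ vs → contract (op s vs)) (nfs-cong ts us (≼-nf ∘ h)) ,
                     +-monoʳ-≤ (symbolWeight s) (weights-mono-≤ ts us (≼-weight ∘ h)) ⟩

  op-≺ : ∀ s (ts us : Vec (Term X) (symbolArity s)) →
         (∀ i → lookup ts i ≼ lookup us i) → ∀ j → lookup ts j ≺ lookup us j → op s ts ≺ op s us
  op-≺ s ts us h j lt =
    ⟨ ≼-nf (op-≼ s ts us h) ,
      +-monoʳ-< (symbolWeight s) (weights-mono-< ts us (≼-weight ∘ h) j (≺-weight lt)) ⟩

-- Hypergraph morphisms

toList-injective : ∀ {A : Set} {k} (xs ys : Vec A k) → toList xs ≡ toList ys → xs ≡ ys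
toList-injective xs ys eq = trans (sym (Vec.cast-is-id refl xs)) (Vec.toList-injective refl xs ys eq)

map-≗ : ∀ {A B : Set} {k} (f h : A → B) (xs : Vec A k) →
        (∀ i → f (lookup xs i) ≡ h (lookup xs i)) → Vec.map f xs ≡ Vec.map h xs
map-≗ f h []       _  = refl
map-≗ f h (x ∷ xs) eq = cong₂ _∷_ (eq zero) (map-≗ f h xs (eq ∘ suc))

head∷tail : ∀ {A : Set} {k} (xs : Vec A (suc k)) → head xs ∷ tail xs ≡ xs
head∷tail (_ ∷ _) = refl

mutual
  -- The occurrence stored in `γ` is irrelevant; decidability allows a relevant one to be recomputed
  -- from it.
  hasVar? : ∀ l → Dec (HasVar l)
  hasVar? (var tt)  = yes here
  hasVar? (op s ps) = map′ (λ (i , x) → there i x) (λ { (there i x) → i , x }) (anyVar? ps)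

  anyVar? : ∀ {k} (ps : Vec Pattern k) → Dec (∃ λ i → HasVar (lookup ps i))
  anyVar? []       = no λ ()
  anyVar? (p ∷ ps) with hasVar? p | anyVar? ps
  ... | yes x | _            = yes (zero , x)
  ... | no _  | yes (i , x)  = yes (suc i , x)
  ... | no ¬x | no ¬any      = no λ { (zero , x) → ¬x x ; (suc i , x) → ¬any (i , x) }

◇-head : ∀ {l} (o : SymbolOcc l) → head (◇att o) ≡ node o
◇-head here        = refl
◇-head (there {ts = ts} i o) with ◇att o | ◇-head {lookup ts i} o
... | _ ∷ _ | refl = refl

module _ {n : ℕ} where

  -- With the label as an index, the attachment strings of an edge and of its image under a morphism
  -- have the same type and need not be compared as lists.

  data Node (G : Hypergraph n) : V G → (l : Label n) → Vec (V G) (arity l) → Set where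
    edge : ∀ e → Node G (res G e) (lab G e) (args G e)

  edgeNode : ∀ (G : Hypergraph n) e {l v} {us : Vec (V G) (arity l)} →
             lab G e ≡ l → toList (att G e) ≡ toList (v ∷ us) → Node G v l us
  edgeNode G e {v = v} {us} refl eq
    with refl ← trans (head∷tail _) (toList-injective (att G e) (v ∷ us) eq) = edge e

  node-arc : ∀ {G : Hypergraph n} {v l us w} → Node G v l us → w ∈ us → Arc G v w
  node-arc (edge e) w∈us = e , refl , w∈us

  module _ {G H : Hypergraph n} (f : Morphism G H) where

    node-map : ∀ {v l us} → Node G v l us → Node H (vmap f v) l (Vec.map (vmap f) us)
    node-map (edge e) = edgeNode H (emap f e) (lab-≡ f e)
      (trans (att-≡ f e) (cong (toList ∘ Vec.map (vmap f)) (sym (head∷tail (att G e)))))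

    res-map : ∀ e → res H (emap f e) ≡ vmap f (res G e)
    res-map e with att H (emap f e) | att G e | att-≡ f e
    ... | _ ∷ _ | _ ∷ _ | eq = List.∷-injectiveˡ eq

    arc-map : ∀ {u w} → Arc G u w → Arc H (vmap f u) (vmap f w)
    arc-map (e , refl , w∈) = node-arc (node-map (edge e)) (∈-map⁺ (vmap f) w∈)

    path-map : ∀ {u w} → Path G u w → Path H (vmap f u) (vmap f w)
    path-map = Star.gmap (vmap f) arc-map

  idᴹ : ∀ {G : Hypergraph n} → Morphism G G
  idᴹ {G} = record
    { vmap  = id
    ; emap  = id
    ; lab-≡ = λ _ → refl
    ; att-≡ = λ e → cong toList (sym (Vec.map-id (att G e)))
    }

  infixr 9 _∘ᴹ_

  _∘ᴹ_ : ∀ {G H K : Hypergraph n} → Morphism H K → Morphism G H → Morphism G K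
  _∘ᴹ_ {G} {H} {K} f h = record
    { vmap  = vmap f ∘ vmap h
    ; emap  = emap f ∘ emap h
    ; lab-≡ = λ e → trans (lab-≡ f (emap h e)) (lab-≡ h e)
    ; att-≡ = λ e → begin
        toList (att K (emap f (emap h e)))                      ≡⟨ att-≡ f (emap h e) ⟩
        toList (Vec.map (vmap f) (att H (emap h e)))            ≡⟨ Vec.toList-map (vmap f) _ ⟩
        List.map (vmap f) (toList (att H (emap h e)))           ≡⟨ cong (List.map (vmap f)) (att-≡ h e) ⟩
        List.map (vmap f) (toList (Vec.map (vmap h) (att G e))) ≡⟨ Vec.toList-map (vmap f) _ ⟨
        toList (Vec.map (vmap f) (Vec.map (vmap h) (att G e)))  ≡⟨ cong toList (Vec.map-∘ _ _ _) ⟨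
        toList (Vec.map (vmap f ∘ vmap h) (att G e))            ∎
    } where open ≡-Reasoning

  inclusion : ∀ (G : Hypergraph n) v → Morphism (G [ v ]ᴴ) G
  inclusion G v = record
    { vmap  = value
    ; emap  = value
    ; lab-≡ = λ _ → refl
    ; att-≡ = λ (e , _) → cong toList (begin
        att G e
          ≡⟨ head∷tail (att G e) ⟨
        res G e ∷ args G e
          ≡⟨ cong (res G e ∷_) (Vec.tabulate∘lookup (args G e)) ⟨
        res G e ∷ tabulate (lookup (args G e))
          ≡⟨ cong (res G e ∷_) (Vec.tabulate-∘ value _) ⟩
        res G e ∷ Vec.map value (tabulate λ i → lookup (args G e) i , _) ∎)
    } where open ≡-Reasoning

  -- Reachability proofs are irrelevant, so `value` is injective and attachment strings may be
  -- compared in `G`.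
  restrict : ∀ {G H : Hypergraph n} {v} (f : Morphism H G) → (∀ x → Path G v (vmap f x)) →
             Morphism H (G [ v ]ᴴ)
  restrict {G} {H} {v} f path = record
    { vmap  = f̂
    ; emap  = f̂ᴱ
    ; lab-≡ = lab-≡ f
    ; att-≡ = λ e → List.map-injective value-injective (begin
        List.map value (toList (att (G [ v ]ᴴ) (f̂ᴱ e)))     ≡⟨ Vec.toList-map value (att (G [ v ]ᴴ) (f̂ᴱ e)) ⟨
        toList (Vec.map value (att (G [ v ]ᴴ) (f̂ᴱ e)))      ≡⟨ att-≡ (inclusion G v) (f̂ᴱ e) ⟨
        toList (att G (emap f e))                            ≡⟨ att-≡ f e ⟩
        toList (Vec.map (value ∘ f̂) (att H e))              ≡⟨ cong toList (Vec.map-∘ value f̂ (att H e)) ⟩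
        toList (Vec.map value (Vec.map f̂ (att H e)))        ≡⟨ Vec.toList-map value _ ⟩
        List.map value (toList (Vec.map f̂ (att H e)))       ∎)
    }
    where
    open ≡-Reasoning

    f̂ : V H → V (G [ v ]ᴴ)
    f̂ x = vmap f x , Irr.[ path x ]

    f̂ᴱ : E H → E (G [ v ]ᴴ)
    f̂ᴱ e = emap f e , Irr.[ subst (Path G v) (sym (res-map f e)) (path (res H e)) ]

  -- Terms of circuits as morphisms into the graph of all terms

  headLabel : Term (Fin n) → Label n
  headLabel (var i)  = input i
  headLabel (op s _) = symbol s

  children : (t : Term (Fin n)) → Vec (Term (Fin n)) (arity (headLabel t))
  children (var _)   = []
  children (op _ ts) = ts

  -- The infinite, fully shared term graph of all terms.  The parts reachable from its nodes are
  -- the maximally collapsed circuits.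

  𝕋 : Hypergraph n
  𝕋 = record
    { V   = Term (Fin n)
    ; E   = Term (Fin n)
    ; lab = headLabel
    ; att = λ t → t ∷ children t
    }

  𝕋-node : ∀ {t l ts} → Node 𝕋 t l ts → t ≡ applyLabel l ts
  𝕋-node (edge (var _))  = refl
  𝕋-node (edge (op _ _)) = refl

  headLabel-apply : ∀ l (ts : Vec (Term (Fin n)) (arity l)) → headLabel (applyLabel l ts) ≡ l
  headLabel-apply (symbol _) _ = refl
  headLabel-apply (input _)  _ = refl

  children-apply : ∀ l (ts : Vec (Term (Fin n)) (arity l)) →
                   toList (children (applyLabel l ts)) ≡ toList ts
  children-apply (symbol _) _  = refl
  children-apply (input _)  [] = refl

  module _ (C : Circuit n) where

    private G = graph C

    nodeAt : ∀ v → ∃₂ λ l us → Node G v l us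
    nodeAt v with uniqueEdge C v
    ... | e , refl , _ = _ , _ , edge e

    edge-injective : ∀ {e e′} → res G e ≡ res G e′ → e ≡ e′
    edge-injective {e} {e′} eq with uniqueEdge C (res G e′)
    ... | _ , _ , unique = trans (sym (unique eq)) (unique refl)

    node-term : ∀ {v l us} → Node G v l us → termAt C v ≡ applyLabel l (Vec.map (termAt C) us)
    node-term (edge e) = termAt-res C e

    toTerms : Morphism G 𝕋
    toTerms = record
      { vmap  = termAt C
      ; emap  = termAt C ∘ res G
      ; lab-≡ = λ e → trans (cong headLabel (termAt-res C e)) (headLabel-apply (lab G e) _)
      ; att-≡ = λ e → begin
          toList (termAt C (res G e) ∷ children (termAt C (res G e)))
            ≡⟨ cong (λ t → termAt C (res G e) List.∷ toList (children t)) (termAt-res C e) ⟩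
          toList (termAt C (res G e) ∷ children (applyLabel (lab G e) (Vec.map (termAt C) (args G e))))
            ≡⟨ cong (termAt C (res G e) List.∷_) (children-apply (lab G e) _) ⟩
          toList (Vec.map (termAt C) (res G e ∷ args G e))
            ≡⟨ cong (toList ∘ Vec.map (termAt C)) (head∷tail (att G e)) ⟩
          toList (Vec.map (termAt C) (att G e)) ∎
      } where open ≡-Reasoning

    -- Induction along arcs: a vertex of `𝕋` is determined by its label and arguments. Hence each
    -- circuit has exactly one vertex map into `𝕋`, and preservation of terms by morphisms follows
    -- by composing with `toTerms`.
    toTerms-unique : (h : Morphism G 𝕋) → ∀ v → vmap h v ≡ termAt C v
    toTerms-unique h v = go v (Arc-wellFounded C v)
      where
      go : ∀ v → Acc (flip (Arc G)) v → vmap h v ≡ termAt C v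
      go v (acc rec) with nodeAt v
      ... | l , us , nd = begin
        vmap h v                              ≡⟨ 𝕋-node (node-map h nd) ⟩
        applyLabel l (Vec.map (vmap h) us)    ≡⟨ cong (applyLabel l) (map-≗ (vmap h) (termAt C) us
                                                   λ i → go (lookup us i) (rec (node-arc nd (∈-lookup i us)))) ⟩
        applyLabel l (Vec.map (termAt C) us)  ≡⟨ node-term nd ⟨
        termAt C v                            ∎
        where open ≡-Reasoning

  termAt-map : ∀ {C D : Circuit n} (f : Morphism (graph C) (graph D)) v → termAt D (vmap f v) ≡ termAt C v
  termAt-map {C} {D} f = toTerms-unique C (toTerms D ∘ᴹ f)

  -- Pattern graphs and instances of patterns

  ◇-lift : ∀ {s ps} i → Morphism {n} (◇ (lookup ps i)) (◇ (op s ps))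
  ◇-lift i = record
    { vmap  = ◇lift i
    ; emap  = there i
    ; lab-≡ = λ _ → refl
    ; att-≡ = λ _ → refl
    }

  ◇-step : ∀ {s ps} i {x} → Path (◇ {n} (lookup ps i)) (◇root (lookup ps i)) x →
           Path (◇ {n} (op s ps)) (node here) (◇lift i x)
  ◇-step {s} {ps} i path =
    node-arc {◇ (op s ps)} (edge here) (∈-tabulate⁺ (λ j → ◇lift j (◇root (lookup ps j))) i) ◅
    path-map (◇-lift {s} {ps} i) path

  ◇-path-node : ∀ {l} (o : SymbolOcc l) → Path (◇ {n} l) (◇root l) (node o)
  ◇-path-node here        = ε
  ◇-path-node (there i o) = ◇-step i (◇-path-node o)

  ◇-path-γ : ∀ {l} (x : HasVar l) → Path (◇ {n} l) (◇root l) (γ x)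
  ◇-path-γ here        = ε
  ◇-path-γ (there i x) = ◇-step i (◇-path-γ x)

  ◇-path : ∀ {l} (x : ◇V l) → Path (◇ {n} l) (◇root l) x
  ◇-path     (node o) = ◇-path-node o
  ◇-path {l} (γ x)    = ◇-path-γ (recompute (hasVar? l) x)

  ◇-inst-morphism : ∀ l → Term (Fin n) → Morphism (◇ l) 𝕋
  ◇-inst-morphism l t = record
    { vmap  = vertex
    ; emap  = occurrence
    ; lab-≡ = lab-occurrence
    ; att-≡ = att-occurrence
    }
    where
    occurrence : ∀ {l} → SymbolOcc l → Term (Fin n)
    occurrence (here {s} {ps}) = inst (op s ps) t
    occurrence (there i o)     = occurrence o

    vertex : ∀ {l} → ◇V l → Term (Fin n)
    vertex (node o) = occurrence o
    vertex (γ _)    = t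

    lab-occurrence : ∀ {l} (o : SymbolOcc l) → headLabel (occurrence o) ≡ symbol (◇symbol o)
    lab-occurrence here        = refl
    lab-occurrence (there i o) = lab-occurrence o

    vertex-root : ∀ l → vertex (◇root l) ≡ inst l t
    vertex-root (var _)  = refl
    vertex-root (op _ _) = refl

    vertex-lift : ∀ {s ps} i x → vertex (◇lift {s} {ps} i x) ≡ vertex x
    vertex-lift i (node _) = refl
    vertex-lift i (γ _)    = refl

    att-occurrence : ∀ {l} (o : SymbolOcc l) →
      toList (occurrence o ∷ children (occurrence o)) ≡ toList (Vec.map vertex (◇att o))
    att-occurrence (here {s} {ps}) = cong (λ ts → toList (inst (op s ps) t ∷ ts)) (begin
      insts ps t
        ≡⟨ Vec.tabulate∘lookup (insts ps t) ⟨
      tabulate (lookup (insts ps t))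
        ≡⟨ Vec.tabulate-cong (λ i → trans (lookup-insts ps t i)
             (sym (trans (vertex-lift {s} {ps} i (◇root (lookup ps i))) (vertex-root (lookup ps i))))) ⟩
      tabulate (λ i → vertex (◇lift {s} {ps} i (◇root (lookup ps i))))
        ≡⟨ Vec.tabulate-∘ vertex _ ⟩
      Vec.map vertex (tabulate λ i → ◇lift {s} {ps} i (◇root (lookup ps i))) ∎)
      where open ≡-Reasoning
    att-occurrence (there {s} {ps} i o) = begin
      toList (occurrence o ∷ children (occurrence o))
        ≡⟨ att-occurrence o ⟩
      toList (Vec.map vertex (◇att o))
        ≡⟨ cong toList (Vec.map-cong (vertex-lift {s} {ps} i) (◇att o)) ⟨
      toList (Vec.map (λ x → vertex (◇lift {s} {ps} i x)) (◇att o))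
        ≡⟨ cong toList (Vec.map-∘ vertex (◇lift i) (◇att o)) ⟩
      toList (Vec.map vertex (Vec.map (◇lift i) (◇att o))) ∎
      where open ≡-Reasoning

  mutual
    -- Matching in `𝕋` is term matching. The instance `t` is a separate parameter because a closed
    -- pattern has no open vertex to read it from.
    ◇-inst : ∀ l {t} (h : Morphism (◇ l) 𝕋) → (∀ .x → vmap h (γ x) ≡ t) → vmap h (◇root l) ≡ inst l t
    ◇-inst (var _)   h hγ = hγ here
    ◇-inst (op s ps) h hγ = trans (𝕋-node (node-map h (edge here)))
      (cong (op s) (trans (sym (Vec.tabulate-∘ (vmap h) _))
        (◇-insts ps (λ i → h ∘ᴹ ◇-lift i) (λ i x → hγ (there i x)))))

    ◇-insts : ∀ {k} (ps : Vec Pattern k) {t} (h : ∀ i → Morphism (◇ (lookup ps i)) 𝕋) →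
              (∀ i → .(x : _) → vmap (h i) (γ x) ≡ t) →
              tabulate (λ i → vmap (h i) (◇root (lookup ps i))) ≡ insts ps t
    ◇-insts []       h hγ = refl
    ◇-insts (p ∷ ps) h hγ = cong₂ _∷_ (◇-inst p (h zero) (hγ zero)) (◇-insts ps (h ∘ suc) (hγ ∘ suc))

-- Circuits as reachable parts, and collapsed circuits

lookup-unique : ∀ {A : Set} {xs : List A} → Unique xs →
                ∀ i j → List.lookup xs i ≡ List.lookup xs j → i ≡ j
lookup-unique (x∉ ∷ u) zero    zero    _  = refl
lookup-unique (x∉ ∷ u) zero    (suc j) eq = contradiction eq (All.lookup x∉ (List.∈-lookup j))
lookup-unique (x∉ ∷ u) (suc i) zero    eq = contradiction (sym eq) (All.lookup x∉ (List.∈-lookup i))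
lookup-unique (x∉ ∷ u) (suc i) (suc j) eq = cong suc (lookup-unique u i j eq)

module _ {n : ℕ} where

  -- A hypergraph need not be finite for its part reachable from a node to be a circuit:
  -- the rank of the node bounds the depth of that part.

  module Prune
    (G : Hypergraph n) (_≟_ : DecidableEquality (V G))
    (rank : V G → ℕ) (arc-rank : ∀ {u w} → Arc G u w → rank w < rank u)
    (unique : ∀ v → ∃! _≡_ λ e → res G e ≡ v) (v₀ : V G)
    where

    edgeAt : V G → E G
    edgeAt v = proj₁ (unique v)

    res-edgeAt : ∀ v → res G (edgeAt v) ≡ v
    res-edgeAt v = proj₁ (proj₂ (unique v))

    edgeAt-res : ∀ e → edgeAt (res G e) ≡ e
    edgeAt-res e = proj₂ (proj₂ (unique (res G e))) refl

    -- The number is fuel. Every arc lowers the rank, so fuel equal to the rank of the starting node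
    -- outlasts all paths from it.
    descendants : ℕ → V G → List (V G)
    descendants zero    v = v List.∷ List.[]
    descendants (suc k) v = v List.∷ List.concatMap (descendants k) (toList (args G (edgeAt v)))

    descendants-sound : ∀ k {v u} → u ∈ᴸ descendants k v → Path G v u
    descendants-sound zero    (Any.here refl) = ε
    descendants-sound (suc k) (Any.here refl) = ε
    descendants-sound (suc k) {v} (Any.there u∈)
      with w , w∈ , u∈w ← find (List.∈-concatMap⁻ (descendants k) u∈) =
      (edgeAt v , res-edgeAt v , ∈-toList⁻ w∈) ◅ descendants-sound k u∈w

    descendants-complete : ∀ k {v u} → rank v ≤ k → Path G v u → u ∈ᴸ descendants k v
    descendants-complete zero    _  ε       = Any.here refl
    descendants-complete (suc k) _  ε       = Any.here refl
    descendants-complete zero    v≤ (a ◅ _) = contradiction (<-≤-trans (arc-rank a) v≤) λ ()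
    descendants-complete (suc k) v≤ (a@(e , refl , w∈) ◅ p) =
      Any.there (List.∈-concatMap⁺ (descendants k) (lose
        (∈-toList⁺ (subst (λ e → _ ∈ args G e) (sym (edgeAt-res e)) w∈))
        (descendants-complete k (s≤s⁻¹ (<-≤-trans (arc-rank a) v≤)) p)))

    nodes : List (V G)
    nodes = List.deduplicate _≟_ (descendants (rank v₀) v₀)

    nodes-sound : ∀ {u} → u ∈ᴸ nodes → Path G v₀ u
    nodes-sound = descendants-sound (rank v₀) ∘ List.∈-deduplicate⁻ _≟_ _

    -- Deciding membership turns an irrelevant path into a relevant list position; with
    -- `nodes-sound` this also restores the path itself, which `reachable` has to produce.
    nodes-complete : ∀ {u} → .(Path G v₀ u) → u ∈ᴸ nodes
    nodes-complete {u} path = recompute (u ∈? nodes)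
      (List.∈-deduplicate⁺ _≟_ (descendants-complete (rank v₀) ≤-refl path))
      where open DecList _≟_ using (_∈?_)

    nodes↔Fin : V (G [ v₀ ]ᴴ) ↔ Fin (List.length nodes)
    nodes↔Fin = mk↔ₛ′
      (λ { (u , Irr.[ path ]) → Any.index (nodes-complete path) })
      (λ i → List.lookup nodes i , Irr.[ nodes-sound (List.∈-lookup i) ])
      (λ i → lookup-unique (deduplicate-! _≟_ (descendants (rank v₀) v₀)) _ i
               (sym (Any.lookup-index (nodes-complete (nodes-sound (List.∈-lookup i))))))
      (λ { (u , Irr.[ path ]) → value-injective (sym (Any.lookup-index (nodes-complete path))) })

    edges↔nodes : E (G [ v₀ ]ᴴ) ↔ V (G [ v₀ ]ᴴ)
    edges↔nodes = mk↔ₛ′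
      (λ (e , path) → res G e , path)
      (λ (u , path) → edgeAt u , Irr.map (subst (Path G v₀) (sym (res-edgeAt u))) path)
      (λ (u , path) → value-injective (res-edgeAt u))
      (λ (e , path) → value-injective (edgeAt-res e))

    path-from : ∀ {x u} .(r : Path G v₀ x) .(s : Path G v₀ u) → Path G x u →
                Path (G [ v₀ ]ᴴ) (x , Irr.[ r ]) (u , Irr.[ s ])
    path-from r s ε = ε
    path-from r s (_◅_ {j = w} a@(e , refl , w∈) p) =
      ((e , Irr.[ r ]) , refl ,
        subst (_∈ args (G [ v₀ ]ᴴ) (e , Irr.[ r ])) (value-injective (sym (lookup-index w∈)))
          (∈-tabulate⁺ _ (index w∈))) ◅
      path-from {w} (r ◅◅ a ◅ ε) s p

    path-rank : ∀ {u w} → TransClosure (Arc G) u w → rank w < rank u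
    path-rank [ a ]   = arc-rank a
    path-rank (a ∷ p) = <-trans (path-rank p) (arc-rank a)

    value⁺ : ∀ {u w} → TransClosure (Arc (G [ v₀ ]ᴴ)) u w → TransClosure (Arc G) (value u) (value w)
    value⁺ [ a ]   = [ arc-map (inclusion G v₀) a ]
    value⁺ (a ∷ p) = arc-map (inclusion G v₀) a ∷ value⁺ p

    prunedCircuit : Circuit n
    prunedCircuit = record
      { graph      = G [ v₀ ]ᴴ
      ; V-finite   = _ , nodes↔Fin
      ; E-finite   = _ , ↔-trans edges↔nodes nodes↔Fin
      ; root       = v₀ , Irr.[ ε ]
      ; reachable  = λ { (u , Irr.[ path ]) → path-from ε path (nodes-sound (nodes-complete path)) }
      ; acyclic    = λ v p → <-irrefl refl (path-rank (value⁺ p))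
      ; uniqueEdge = λ (u , path) →
          (edgeAt u , Irr.map (subst (Path G v₀) (sym (res-edgeAt u))) path) ,
          value-injective (res-edgeAt u) ,
          λ { refl → value-injective (edgeAt-res _) }
      }

  open Normalisation (Fin._≟_ {n}) public

  𝕋-arc-weight : ∀ {t u : Term (Fin n)} → Arc 𝕋 t u → weight u < weight t
  𝕋-arc-weight (op s ts , refl , u∈) =
    ≤-<-trans (subst (λ u → weight u ≤ weights ts) (sym (lookup-index u∈)) (lookup-weights ts (index u∈)))
      (weights-< s ts)

  module 𝕋 = Prune 𝕋 _≟ᵗ_ weight 𝕋-arc-weight (λ t → t , refl , sym)

  collapsed : Term (Fin n) → Circuit n
  collapsed = 𝕋.prunedCircuit

  termAt-collapsed : ∀ t u → termAt (collapsed t) u ≡ value u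
  termAt-collapsed t u = sym (toTerms-unique (collapsed t) (inclusion 𝕋 t) u)

  term-collapsed : ∀ t → term (collapsed t) ≡ t
  term-collapsed t = termAt-collapsed t (root (collapsed t))

  collapse : ∀ C → Morphism (graph C) (graph (collapsed (term C)))
  collapse C = restrict (toTerms C) (path-map (toTerms C) ∘ reachable C)

-- Proper steps decrease the term

rule-hasVar : ∀ {l r} → l ▷ r → HasVar r → HasVar l
rule-hasVar 0▷¬1    (there zero (there () _))
rule-hasVar ¬¬g▷g   _ = there zero (there zero here)
rule-hasVar g∧g▷g   _ = there zero here
rule-hasVar g∨g▷g   _ = there zero here
rule-hasVar g∧¬1▷¬1 _ = there zero here
rule-hasVar ¬1∧g▷¬1 _ = there (suc zero) here
rule-hasVar g∨1▷1   _ = there zero here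
rule-hasVar 1∨g▷1   _ = there (suc zero) here
rule-hasVar g∧1▷g   _ = there zero here
rule-hasVar 1∧g▷g   _ = there (suc zero) here
rule-hasVar g∨¬1▷g  _ = there zero here
rule-hasVar ¬1∨g▷g  _ = there (suc zero) here
rule-hasVar g∧¬g▷¬1 _ = there zero here
rule-hasVar ¬g∧g▷¬1 _ = there (suc zero) here
rule-hasVar g∨¬g▷1  _ = there zero here
rule-hasVar ¬g∨g▷1  _ = there (suc zero) here

hasVar-weight : ∀ {X : Set} {l} → HasVar l → (t : Term X) → weight t ≤ weight (inst l t)
hasVar-weight here t = ≤-refl
hasVar-weight (there {s} {ps} i x) t =
  ≤-trans (hasVar-weight x t) (≤-trans
    (subst (λ u → weight u ≤ weights (insts ps t)) (lookup-insts ps t i) (lookup-weights (insts ps t) i))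
    (<⇒≤ (weights-< s (insts ps t))))

module _ {n : ℕ} where

  ⊎-inj₁ : ∀ {G H : Hypergraph n} → Morphism G (G ⊎ᴴ H)
  ⊎-inj₁ = record { vmap = inj₁ ; emap = inj₁ ; lab-≡ = λ _ → refl ; att-≡ = λ _ → refl }

  ⊎-inj₂ : ∀ {G H : Hypergraph n} → Morphism H (G ⊎ᴴ H)
  ⊎-inj₂ = record { vmap = inj₂ ; emap = inj₂ ; lab-≡ = λ _ → refl ; att-≡ = λ _ → refl }

  node-∖ : ∀ {G : Hypergraph n} {e v l us} → Node G v l us → v ≢ res G e → Node (G ∖ e) v l us
  node-∖ (edge e′) v≢ = edge (e′ , Irr.[ (λ { refl → v≢ refl }) ])

  _≟ⱽ_ : ∀ {C : Circuit n} → DecidableEquality (V (graph C))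
  _≟ⱽ_ {C} = Fin.inj⇒≟ (↔⇒↣ (proj₂ (V-finite C)))

  apply-≼ : ∀ l (ts us : Vec (Term (Fin n)) (arity l)) →
            (∀ i → lookup ts i ≼ lookup us i) → applyLabel l ts ≼ applyLabel l us
  apply-≼ (symbol s) ts us h = op-≼ s ts us h
  apply-≼ (input i)  _  _  _ = ≼-refl

  apply-≺ : ∀ l (ts us : Vec (Term (Fin n)) (arity l)) → (∀ i → lookup ts i ≼ lookup us i) →
            ∀ j → lookup ts j ≺ lookup us j → applyLabel l ts ≺ applyLabel l us
  apply-≺ (symbol s) ts us h j lt = op-≺ s ts us h j lt

  γ-image : ∀ {l} (h : Morphism {n} (◇ l) 𝕋) → ∃ λ t → ∀ .x → vmap h (γ x) ≡ t
  γ-image {l} h with hasVar? l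
  ... | yes x = vmap h (γ x) , λ _ → refl
  -- A default for closed patterns: without an open vertex the condition is vacuous.
  ... | no ¬x = 1ᵗ , λ x → contradiction-irr x ¬x

  arc-weight : ∀ (C : Circuit n) {u w} → Arc (graph C) u w → weight (termAt C w) < weight (termAt C u)
  arc-weight C = 𝕋-arc-weight ∘ arc-map (toTerms C)

  module Redex (C : Circuit n) {l} {v} (p : Morphism (◇ l) (graph C [ v ]ᴴ))
               (p-root : value (vmap p (◇root l)) ≡ v) where

    private
      f : Morphism (◇ l) 𝕋
      f = toTerms C ∘ᴹ inclusion (graph C) v ∘ᴹ p

    argument : Term (Fin n)
    argument = proj₁ (γ-image f)

    termAt-γ : ∀ .x → termAt C (value (vmap p (γ x))) ≡ argument
    termAt-γ = proj₂ (γ-image f)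

    termAt-redex : termAt C v ≡ inst l argument
    termAt-redex = trans (cong (termAt C) (sym p-root)) (◇-inst l f termAt-γ)

  module _ {C D : Circuit n} (properStep : ProperStep C D) where

    open ProperStep properStep

    private
      U = (graph C ∖ e) ⊎ᴴ ◇ r

      q : V U → V K
      q = vmap glue

      prune′ : Morphism (graph D) K
      prune′ = inclusion K rootᴷ ∘ᴹ prune

      h : V (graph D) → V K
      h = vmap prune′

      h-injective : ∀ {d d′} → h d ≡ h d′ → d ≡ d′
      h-injective eq = proj₁ (proj₁ prune-bijective) (value-injective eq)

    -- The label is generalised to a variable `l`, so that the equation with the label of `e′` can
    -- be eliminated and argument vectors get the same length.
    reindex : ∀ e′ {l v} {us : Vec (V U) (arity l)} → lab (graph D) e′ ≡ l →
              toList (Vec.map h (att (graph D) e′)) ≡ toList (Vec.map q (v ∷ us)) →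
              ∃ λ ds → Node (graph D) (res (graph D) e′) l ds ×
                       h (res (graph D) e′) ≡ q v × Vec.map h ds ≡ Vec.map q us
    reindex e′ {v = v} {us} refl eq
      with eq′ ← toList-injective (Vec.map h (att (graph D) e′)) (Vec.map q (v ∷ us)) eq = args (graph D) e′ , edge e′ ,
        Vec.∷-injective (trans (cong (Vec.map h) (head∷tail (att (graph D) e′))) eq′)

    -- The edge at `y` becomes an edge of `K` with result `q y`. As `q y` equals `h d`, it is
    -- reachable and the edge survives pruning; so it comes from an edge of `D`, whose result is `d`
    -- because `h` is injective.
    node-lift : ∀ {d y l us} → Node U y l us → h d ≡ q y →
                ∃ λ ds → Node (graph D) d l ds × (∀ i → h (lookup ds i) ≡ q (lookup us i))
    node-lift {d} (edge a) hd
      with e′ , hit ← proj₂ (proj₂ prune-bijective)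
                        (emap glue a , Irr.map (subst (Path K rootᴷ) (trans hd (sym (res-map glue a))))
                                         (proof (vmap prune d)))
      with hit′ ← cong value (hit refl)
      with ds , nd , hr , hs ← reindex e′ {us = args U a}
             (trans (sym (lab-≡ prune′ e′)) (trans (cong (lab K) hit′) (lab-≡ glue a)))
             (trans (sym (att-≡ prune′ e′)) (trans (cong (toList ∘ att K) hit′) (trans (att-≡ glue a)
               (cong (toList ∘ Vec.map q) (sym (head∷tail (att U a)))))))
      with refl ← h-injective (trans hd (sym hr)) = ds , nd , λ i → begin
      h (lookup ds i)                  ≡⟨ Vec.lookup-map i h ds ⟨
      lookup (Vec.map h ds) i          ≡⟨ cong (λ vs → lookup vs i) hs ⟩
      lookup (Vec.map q (args U a)) i  ≡⟨ Vec.lookup-map i q (args U a) ⟩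
      q (lookup (args U a) i)          ∎
      where open ≡-Reasoning

    mutual
      -- The symbols of `ρ` are found again below `d` one by one through `node-lift`; at the open
      -- vertex the assumed bound takes over.
      inst-≼ : ∀ ρ (k : Morphism (◇ ρ) U) {t d} → h d ≡ q (vmap k (◇root ρ)) →
               (∀ .x d → h d ≡ q (vmap k (γ x)) → termAt D d ≼ t) → termAt D d ≼ inst ρ t
      inst-≼ (var _)   k hd hγ = hγ here _ hd
      inst-≼ (op s ps) k {t} {d} hd hγ with node-lift (node-map k (edge here)) hd
      ... | ds , nd , hds = subst (_≼ inst (op s ps) t) (sym (node-term D nd))
        (op-≼ s (Vec.map (termAt D) ds) (insts ps t) λ i →
          subst (_≼ lookup (insts ps t) i) (sym (Vec.lookup-map i (termAt D) ds))
            (insts-≼ ps i (k ∘ᴹ ◇-lift i)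
              (trans (hds i) (cong q (trans (Vec.lookup-map i (vmap k) (tabulate (child ps)))
                                            (cong (vmap k) (Vec.lookup∘tabulate (child ps) i)))))
              λ x → hγ (there i x)))
        where
        child : (ps : Vec Pattern (symbolArity s)) → Fin (symbolArity s) → ◇V (op s ps)
        child ps i = ◇lift i (◇root (lookup ps i))

      insts-≼ : ∀ {m} (ps : Vec Pattern m) i (k : Morphism (◇ (lookup ps i)) U) {t d} →
                h d ≡ q (vmap k (◇root (lookup ps i))) →
                (∀ .x d → h d ≡ q (vmap k (γ x)) → termAt D d ≼ t) → termAt D d ≼ lookup (insts ps t) i
      insts-≼ (p ∷ ps) zero    k hd hγ = inst-≼ p k hd hγ
      insts-≼ (p ∷ ps) (suc i) k hd hγ = insts-≼ ps i k hd hγ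

    -- K is known through its quotient property only and has no terms of its own, so the terms of
    -- C and D are compared along this relation.

    Related : V (graph C) → V (graph D) → Set
    Related x d = h d ≡ q (inj₁ x)

    identified : ∀ {x y} → Identified v {l} {r} p x y → q x ≡ q y
    identified x~y = Equivalence.from (IsQuotient.vmap-kernel glue-quot _ _) (fwd x~y ◅ ε)

    descend : ∀ {x l us d} → Node (graph C) x l us → x ≢ v → Related x d →
              ∃ λ ds → Node (graph D) d l ds × (∀ i → Related (lookup us i) (lookup ds i))
    descend {us = us} nd x≢v rel
      with ds , nd′ , hds ← node-lift (node-map ⊎-inj₁ (node-∖ nd λ x≡ → x≢v (trans x≡ e-res))) rel =
      ds , nd′ , λ i → trans (hds i) (cong q (Vec.lookup-map i inj₁ us))

    open Redex C p p-root

    -- If `r` is `g`, the contracted node is merged with the image of `γ`, and the recursive call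
    -- keeps the same `d`. Progress is therefore measured by the weight of the term in `C`: the
    -- argument weighs less than the redex.
    contracted-≺ : (∀ x d → weight (termAt C x) < weight (termAt C v) →
                            Related x d → termAt D d ≼ termAt C x) →
                   ∀ {d} → Related v d → termAt D d ≺ termAt C v
    contracted-≺ rec {d} rel = subst (termAt D d ≺_) (sym termAt-redex) (≼-≺-trans
      (inst-≼ r ⊎-inj₂ (trans rel (identified root≈)) argument-≼)
      (rule-≺ rule argument))
      where
      argument-≼ : ∀ .x d → h d ≡ q (inj₂ (γ x)) → termAt D d ≼ argument
      argument-≼ x d hd = subst (termAt D d ≼_) (termAt-γ x′)
        (rec (value (vmap p (γ x′))) d
          (subst₂ (λ s u → weight s < weight u) (sym (termAt-γ x′)) (sym termAt-redex)
            (≤-<-trans (hasVar-weight (recompute (hasVar? r) x) argument) (rule-weight rule argument)))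
          (trans hd (sym (identified (γ≈ {h = x′} {recompute (hasVar? r) x})))))
        where
        x′ = rule-hasVar rule (recompute (hasVar? r) x)

    related-≼ : ∀ x d → Related x d → termAt D d ≼ termAt C x
    related-≼ x d = go x d (<-wellFounded _)
      where
      go : ∀ x d → Acc _<_ (weight (termAt C x)) → Related x d → termAt D d ≼ termAt C x
      go x d (acc rs) rel with _≟ⱽ_ {C} x v
      ... | yes refl = ≺⇒≼ (contracted-≺ (λ x d lt → go x d (rs lt)) rel)
      ... | no x≢v with l , us , nd ← nodeAt C x with ds , nd′ , rels ← descend nd x≢v rel =
        subst₂ _≼_ (sym (node-term D nd′)) (sym (node-term C nd))
          (apply-≼ l (Vec.map (termAt D) ds) (Vec.map (termAt C) us) λ i →
            subst₂ _≼_ (sym (Vec.lookup-map i (termAt D) ds)) (sym (Vec.lookup-map i (termAt C) us))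
              (go (lookup us i) (lookup ds i)
                (rs (arc-weight C (node-arc nd (∈-lookup i us)))) (rels i)))

    -- Strictness travels from `v` upwards: at each node on the path one argument decreases strictly
    -- and the others do not grow. As `v` is reachable from the root, the whole term decreases.
    related-≺ : ∀ {x d} → Path (graph C) x v → Related x d → termAt D d ≺ termAt C x
    related-≺ {x} ε rel = contracted-≺ (λ x d _ → related-≼ x d) rel
    related-≺ {x} {d} (a ◅ path) rel with _≟ⱽ_ {C} x v
    -- Acyclicity excludes a return to `v`, but the bound at `v` settles this case directly.
    ... | yes refl = contracted-≺ (λ x d _ → related-≼ x d) rel
    related-≺ {x} {d} ((e′ , refl , u∈) ◅ path) rel | no x≢v
      with ds , nd′ , rels ← descend (edge e′) x≢v rel =
        subst₂ _≺_ (sym (node-term D nd′)) (sym (node-term C (edge e′)))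
          (apply-≺ (lab (graph C) e′) (Vec.map (termAt D) ds) (Vec.map (termAt C) us)
            (λ i → subst₂ _≼_ (eqD i) (eqC i) (related-≼ _ _ (rels i)))
            j (subst₂ _≺_ (eqD j) (trans (cong (termAt C) (lookup-index u∈)) (eqC j))
              (related-≺ path (subst (λ u → Related u (lookup ds j)) (sym (lookup-index u∈)) (rels j)))))
      where
      us = args (graph C) e′
      j  = index u∈
      eqC = λ i → sym (Vec.lookup-map i (termAt C) us)
      eqD = λ i → sym (Vec.lookup-map i (termAt D) ds)

    properStep-≺ : term D ≺ term C
    properStep-≺ = related-≺ (reachable C v) prune-root

-- Constructing the contraction of a redex

head-map : ∀ {A B : Set} {k} (f : A → B) (xs : Vec A (suc k)) → head (Vec.map f xs) ≡ f (head xs)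
head-map f (_ ∷ _) = refl

tail-map : ∀ {A B : Set} {k} (f : A → B) (xs : Vec A (suc k)) → tail (Vec.map f xs) ≡ Vec.map f (tail xs)
tail-map f (_ ∷ _) = refl

_≟ᵒ_ : ∀ {l} → DecidableEquality (SymbolOcc l)
here      ≟ᵒ here       = yes refl
here      ≟ᵒ there _ _  = no λ ()
there _ _ ≟ᵒ here       = no λ ()
there i o ≟ᵒ there j o′ with i Fin.≟ j
... | no i≢j   = no λ { refl → i≢j refl }
... | yes refl = map′ (cong (there i)) (λ { refl → refl }) (o ≟ᵒ o′)

module _ {n : ℕ} where

  ∖-inclusion : ∀ {G : Hypergraph n} {e} → Morphism (G ∖ e) G
  ∖-inclusion {G} = record
    { vmap  = id
    ; emap  = value
    ; lab-≡ = λ _ → refl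
    ; att-≡ = λ (e , _) → cong toList (sym (Vec.map-id (att G e)))
    }

  [_,_]ᴹ : ∀ {G H K : Hypergraph n} → Morphism G K → Morphism H K → Morphism (G ⊎ᴴ H) K
  [_,_]ᴹ {G} {H} f h = record
    { vmap  = Sum.[ vmap f , vmap h ]
    ; emap  = Sum.[ emap f , emap h ]
    ; lab-≡ = λ { (inj₁ e) → lab-≡ f e ; (inj₂ e) → lab-≡ h e }
    ; att-≡ = λ { (inj₁ e) → trans (att-≡ f e) (cong toList (Vec.map-∘ _ inj₁ (att G e)))
                ; (inj₂ e) → trans (att-≡ h e) (cong toList (Vec.map-∘ _ inj₂ (att H e))) }
    }

  module Contraction (C : Circuit n) {l r} (rule : l ▷ r) {v} (p : Morphism (◇ l) (graph C [ v ]ᴴ))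
                     (p-root : value (vmap p (◇root l)) ≡ v) where

    open Redex C p p-root

    e : E (graph C)
    e = proj₁ (uniqueEdge C v)

    e-res : res (graph C) e ≡ v
    e-res = proj₁ (proj₂ (uniqueEdge C v))

    U : Hypergraph n
    U = (graph C ∖ e) ⊎ᴴ ◇ r

    -- Canonical representatives of the identified classes: `v` is represented by whatever the root
    -- of `◇ r` becomes, and the open vertex by its image in `C`.
    Vᴷ : Set
    Vᴷ = [ x ∈ V (graph C) ∣ x ≢ v ] ⊎ SymbolOcc r

    -- The argument weighs less than the redex. Thus, when `r` is `g`, the place of `v` is taken by
    -- a different old node, whose edge has not been deleted.
    γ-≢ : (x : HasVar r) → value (vmap p (γ (rule-hasVar rule x))) ≢ v
    γ-≢ x eq = <-irrefl (cong weight (trans (sym (termAt-γ x′)) (trans (cong (termAt C) eq) termAt-redex)))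
      (≤-<-trans (hasVar-weight x argument) (rule-weight rule argument))
      where x′ = rule-hasVar rule x

    place◇ : ◇V r → Vᴷ
    place◇ (node o) = inj₂ o
    place◇ (γ x)    = inj₁ (value (vmap p (γ (rule-hasVar rule x))) , Irr.[ γ-≢ x ])

    place : ∀ x → Dec (x ≡ v) → Vᴷ
    place x (yes _)  = place◇ (◇root r)
    place x (no x≢v) = inj₁ (x , Irr.[ x≢v ])

    q : V U → Vᴷ
    q (inj₁ x) = place x (_≟ⱽ_ {C = C} x v)
    q (inj₂ y) = place◇ y

    q-v : q (inj₁ v) ≡ place◇ (◇root r)
    q-v with _≟ⱽ_ {C = C} v v
    ... | yes _  = refl
    ... | no v≢v = contradiction refl v≢v

    q-≢ : ∀ {x} .(x≢v : x ≢ v) → q (inj₁ x) ≡ inj₁ (x , Irr.[ x≢v ])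
    q-≢ {x} x≢v with _≟ⱽ_ {C = C} x v
    ... | yes x≡v = contradiction-irr x≢v λ n → n x≡v
    ... | no _    = refl

    K : Hypergraph n
    K = record { V = Vᴷ ; E = E U ; lab = lab U ; att = λ a → Vec.map q (att U a) }

    glue : Morphism U K
    glue = record { vmap = q ; emap = id ; lab-≡ = λ _ → refl ; att-≡ = λ _ → refl }

    _~_ : V U → V U → Set
    _~_ = EqClosure (Identified {G = graph C} v {l} {r} p)

    representative : Vᴷ → V U
    representative (inj₁ (x , _)) = inj₁ x
    representative (inj₂ o)       = inj₂ (node o)

    ◇~representative : ∀ y → inj₂ y ~ representative (place◇ y)
    ◇~representative (node o) = ε
    ◇~representative (γ x)    = bwd (γ≈ {h = rule-hasVar rule x′} {h′ = x′}) ◅ ε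
      where x′ = recompute (hasVar? r) x

    ~representative : ∀ y → y ~ representative (q y)
    ~representative (inj₂ y) = ◇~representative y
    ~representative (inj₁ x) with _≟ⱽ_ {C = C} x v
    ... | yes refl = fwd root≈ ◅ ◇~representative (◇root r)
    ... | no _     = ε

    q-identified : ∀ {x y} → Identified {G = graph C} v {l} {r} p x y → q x ≡ q y
    q-identified root≈            = q-v
    q-identified (γ≈ {h′ = h′})   = q-≢ (γ-≢ h′)

    q-representative : ∀ y → q (representative y) ≡ y
    q-representative (inj₁ (x , Irr.[ x≢v ])) = q-≢ x≢v
    q-representative (inj₂ o) = refl

    glue-quot : IsQuotient (Identified {G = graph C} v {l} {r} p) glue
    glue-quot = record
      { vmap-surjective = λ y → representative y , λ { refl → q-representative y }
      ; vmap-kernel     = λ x y → mk⇔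
          (λ eq → ~representative x ◅◅ subst (λ z → representative z ~ y) (sym eq)
                    (EqClosure.symmetric _ (~representative y)))
          (EqClosure.gfold isEquivalence q q-identified)
      ; emap-bijective  = id , λ a → a , id
      }

    toTermsᵁ : Morphism U 𝕋
    toTermsᵁ = [ toTerms C ∘ᴹ ∖-inclusion {graph C} {e} , ◇-inst-morphism r argument ]ᴹ

    -- Acyclicity must be known before `K` yields a circuit with terms. The rank therefore uses the
    -- weights before contraction for old nodes, and those of the instance of `r` for new ones.
    rank : Vᴷ → ℕ
    rank (inj₁ (x , _)) = weight (termAt C x)
    rank (inj₂ o)       = weight (vmap toTermsᵁ (inj₂ (node o)))

    rank-place◇ : ∀ y → rank (place◇ y) ≡ weight (vmap toTermsᵁ (inj₂ y))
    rank-place◇ (node o) = refl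
    rank-place◇ (γ x)    = cong weight (termAt-γ (rule-hasVar rule x))

    -- The only redirected arcs are those into `v`. Their new target has the rank of the contractum,
    -- which `rule-weight` makes smaller, so arcs of `K` still descend.
    rank-q : ∀ y → rank (q y) ≤ weight (vmap toTermsᵁ y)
    rank-q (inj₂ y) = ≤-reflexive (rank-place◇ y)
    rank-q (inj₁ x) with _≟ⱽ_ {C = C} x v
    ... | no _     = ≤-refl
    ... | yes refl = begin
      rank (place◇ (◇root r))                    ≡⟨ rank-place◇ (◇root r) ⟩
      weight (vmap toTermsᵁ (inj₂ (◇root r)))    ≡⟨ cong weight (◇-inst r (◇-inst-morphism r argument)
                                                      λ _ → refl) ⟩
      weight (inst r argument)                   <⟨ rule-weight rule argument ⟩
      weight (inst l argument)                   ≡⟨ cong weight termAt-redex ⟨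
      weight (termAt C x)                        ∎
      where open ≤-Reasoning

    resᴷ : E U → Vᴷ
    resᴷ (inj₁ (a , Irr.[ a≢e ])) =
      inj₁ (res (graph C) a , Irr.[ (λ eq → a≢e (edge-injective C (trans eq (sym e-res)))) ])
    resᴷ (inj₂ o) = inj₂ o

    res-resᴷ : ∀ a → res K a ≡ resᴷ a
    res-resᴷ (inj₁ (a , Irr.[ a≢e ])) =
      trans (head-map q (Vec.map inj₁ (att (graph C) a))) (trans
        (cong q (head-map inj₁ (att (graph C) a)))
        (q-≢ λ eq → a≢e (edge-injective C (trans eq (sym e-res)))))
    res-resᴷ (inj₂ o) =
      trans (head-map q (Vec.map inj₂ (◇att o))) (cong q
        (trans (head-map inj₂ (◇att o)) (cong inj₂ (◇-head o))))

    rank-res : ∀ a → rank (res K a) ≡ weight (vmap toTermsᵁ (res U a))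
    rank-res a@(inj₁ (a′ , _)) = trans (cong rank (res-resᴷ a))
      (cong (weight ∘ vmap toTermsᵁ) (sym (head-map inj₁ (att (graph C) a′))))
    rank-res a@(inj₂ o)        = trans (cong rank (res-resᴷ a))
      (cong (weight ∘ vmap toTermsᵁ) (sym (trans (head-map inj₂ (◇att o)) (cong inj₂ (◇-head o)))))

    arc-rank : ∀ {x y} → Arc K x y → rank y < rank x
    arc-rank {y = y} (a , refl , y∈) = begin-strict
      rank y                                       ≡⟨ cong rank (lookup-index y∈) ⟩
      rank (lookup (args K a) i)                   ≡⟨ cong (λ ys → rank (lookup ys i)) (tail-map q (att U a)) ⟩
      rank (lookup (Vec.map q (args U a)) i)       ≡⟨ cong rank (Vec.lookup-map i q (args U a)) ⟩
      rank (q (lookup (args U a) i))               ≤⟨ rank-q (lookup (args U a) i) ⟩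
      weight (vmap toTermsᵁ (lookup (args U a) i)) <⟨ 𝕋-arc-weight (arc-map toTermsᵁ
                                                        (a , refl , ∈-lookup i (args U a))) ⟩
      weight (vmap toTermsᵁ (res U a))             ≡⟨ rank-res a ⟨
      rank (res K a)                               ∎
      where
      open ≤-Reasoning
      i = index y∈

    edgeᴷ : Vᴷ → E U
    edgeᴷ (inj₁ (x , Irr.[ x≢v ])) with uniqueEdge C x
    ... | a , res≡x , _ = inj₁ (a , Irr.[ (λ { refl → x≢v (trans (sym res≡x) e-res) }) ])
    edgeᴷ (inj₂ o) = inj₂ o

    resᴷ-edgeᴷ : ∀ y → resᴷ (edgeᴷ y) ≡ y
    resᴷ-edgeᴷ (inj₁ (x , _)) with uniqueEdge C x
    ... | a , refl , _ = refl
    resᴷ-edgeᴷ (inj₂ o) = refl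

    edgeᴷ-resᴷ : ∀ a → edgeᴷ (resᴷ a) ≡ a
    edgeᴷ-resᴷ (inj₁ (a , _)) with uniqueEdge C (res (graph C) a)
    ... | a′ , res≡ , unique = cong inj₁ (value-injective (unique refl))
    edgeᴷ-resᴷ (inj₂ o) = refl

    module Kᴾ = Prune K (Sum.≡-dec (Refinement._≟_ (_≟ⱽ_ {C = C})) _≟ᵒ_) rank arc-rank
      (λ y → edgeᴷ y , trans (res-resᴷ (edgeᴷ y)) (resᴷ-edgeᴷ y) ,
             λ {a} eq → trans (cong edgeᴷ (trans (sym eq) (res-resᴷ a))) (edgeᴷ-resᴷ a))
      (q (inj₁ (root C)))

    contracted : Circuit n
    contracted = Kᴾ.prunedCircuit

    properStep : ProperStep C contracted
    properStep = record
      { rule = rule ; v = v ; p = p ; p-root = p-root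
      ; e = e ; e-res = e-res
      ; K = K ; glue = glue ; glue-quot = glue-quot
      ; prune = idᴹ
      ; prune-bijective = (id , λ x → x , id) , (id , λ a → a , id)
      ; prune-root = refl
      }

  -- Redexes of collapsed circuits

  -- Subterms are given by paths in `𝕋`, because such a path is exactly what makes a term a vertex
  -- of `collapsed t`.
  data Reducible (t : Term (Fin n)) : Set where
    redex : ∀ {l r} → l ▷ r → ∀ u → Path 𝕋 t (inst l u) → Reducible t

  mutual
    reducible? : ∀ t → Reducible t ⊎ nf t ≡ t
    reducible? (var _)   = inj₂ refl
    reducible? (op s ts) with reducibles? ts
    ... | inj₁ (i , redex rule u path) = inj₁ (redex rule u ((op s ts , refl , ∈-lookup i ts) ◅ path))
    ... | inj₂ eq with rootRedex? (op s ts)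
    ...   | yes (_ , _ , rule , u , eq′) = inj₁ (redex rule u (subst (Path 𝕋 (op s ts)) eq′ ε))
    ...   | no ¬redex = inj₂ (trans (cong (contract ∘ op s) eq) (contract-¬redex ¬redex))

    reducibles? : ∀ {k} (ts : Vec (Term (Fin n)) k) → (∃ λ i → Reducible (lookup ts i)) ⊎ nfs ts ≡ ts
    reducibles? []       = inj₂ refl
    reducibles? (t ∷ ts) with reducible? t | reducibles? ts
    ... | inj₁ red | _              = inj₁ (zero , red)
    ... | inj₂ _   | inj₁ (i , red) = inj₁ (suc i , red)
    ... | inj₂ eq  | inj₂ eqs       = inj₂ (cong₂ _∷_ eq eqs)

  reduce : ∀ {t} → Reducible t → ∃ λ D → ProperStep (collapsed t) D
  reduce {t} (redex {l} rule u path) = _ , Contraction.properStep (collapsed t) rule p refl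
    where
    root-path : ∀ x → Path 𝕋 (inst l u) (vmap (◇-inst-morphism l u) x)
    root-path x = subst (λ s → Path 𝕋 s (vmap (◇-inst-morphism l u) x))
      (◇-inst l (◇-inst-morphism l u) λ _ → refl)
      (path-map (◇-inst-morphism l u) (◇-path {n} x))

    m : Morphism (◇ l) (graph (collapsed t))
    m = restrict (◇-inst-morphism l u) λ x → path ◅◅ root-path x

    p : Morphism (◇ l) (graph (collapsed t) [ vmap m (◇root l) ]ᴴ)
    p = restrict m (path-map m ∘ ◇-path {n})

-- Collapse steps, isomorphisms and the number of nodes

-- A section of f that misses a point maps Fin n injectively into Fin (m − 1).

section⇒injective : ∀ {m n} (f : Fin m → Fin n) (s : Fin n → Fin m) → (∀ j → f (s j) ≡ j) →
                    m ≤ n → Injective _≡_ _≡_ f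
section⇒injective {m} {n} f s f∘s m≤n {i} {i′} eq =
  goal (hit m≤n s s-injective i) (hit m≤n s s-injective i′)
  where
  s-injective : Injective _≡_ _≡_ s
  s-injective {j} {j′} eq = trans (sym (f∘s j)) (trans (cong f eq) (f∘s j′))

  hit : ∀ {m} → m ≤ n → (s : Fin n → Fin m) → Injective _≡_ _≡_ s → ∀ i → ∃ λ j → s j ≡ i
  hit {suc m} m≤n s inj i with Fin.any? (λ j → s j Fin.≟ i)
  ... | yes found = found
  ... | no miss   = contradiction m≤n (≤⇒≯ (Fin.injective⇒≤ {f = λ j → punchOut (i≢s j)}
                      λ eq → inj (Fin.punchOut-injective (i≢s _) (i≢s _) eq)))
    where
    i≢s : ∀ j → i ≢ s j
    i≢s j i≡sj = miss (j , sym i≡sj)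

  goal : (∃ λ j → s j ≡ i) → (∃ λ j → s j ≡ i′) → i ≡ i′
  goal (j , refl) (j′ , refl) = cong s (trans (sym (f∘s j)) (trans eq (f∘s j′)))

module _ {n : ℕ} where

  size : Circuit n → ℕ
  size C = proj₁ (V-finite C)

  private
    module Index (C : Circuit n) = Inverse (proj₂ (V-finite C))

  injective⇒size-≤ : ∀ {C D : Circuit n} (f : V (graph C) → V (graph D)) →
                     Injective _≡_ _≡_ f → size C ≤ size D
  injective⇒size-≤ {C} {D} f inj = Fin.injective⇒≤ {f = Index.to D ∘ f ∘ Index.from C}
    λ eq → from-injective (inj (to-injective eq))
    where
    to-injective : Injective _≡_ _≡_ (Index.to D)
    to-injective {x} {y} eq =
      trans (sym (Index.strictlyInverseʳ D x)) (trans (cong (Index.from D) eq) (Index.strictlyInverseʳ D y))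

    from-injective : Injective _≡_ _≡_ (Index.from C)
    from-injective {x} {y} eq =
      trans (sym (Index.strictlyInverseˡ C x)) (trans (cong (Index.to C) eq) (Index.strictlyInverseˡ C y))

  arc-node : ∀ (C : Circuit n) {v l us w} → Node (graph C) v l us → Arc (graph C) v w → w ∈ us
  arc-node C (edge a) (a′ , res≡ , w∈) with refl ← edge-injective C {a′} {a} res≡ = w∈

  path-antisym : ∀ (C : Circuit n) {u w} → Path (graph C) u w → Path (graph C) w u → u ≡ w
  path-antisym C ε       _ = refl
  path-antisym C (a ◅ p) q = contradiction (plus a (p ◅◅ q)) (acyclic C _)
    where
    plus : ∀ {u w x} → Arc (graph C) u w → Path (graph C) w x → TransClosure (Arc (graph C)) u x
    plus a ε       = [ a ]
    plus a (b ◅ p) = a ∷ plus b p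

  module _ {C D : Circuit n} (f : Morphism (graph C) (graph D)) where

    vmap-injective⇒injective : Injective _≡_ _≡_ (vmap f) → IsInjective f
    vmap-injective⇒injective inj = inj , λ {a} {a′} eq →
      edge-injective C (inj (trans (sym (res-map f a)) (trans (cong (res (graph D)) eq) (res-map f a′))))

    module _ (f-root : vmap f (root C) ≡ root D) where

      term-map : term D ≡ term C
      term-map = trans (cong (termAt D) (sym f-root)) (termAt-map {C = C} {D} f (root C))

      -- The unique edge at `vmap f x` is the image of the edge at `x`, so every arc out of
      -- `vmap f x` lifts. Morphisms that preserve the root are therefore onto.
      path-lift : ∀ {x u y} → vmap f x ≡ u → Path (graph D) u y → ∃ λ x′ → vmap f x′ ≡ y
      path-lift {x} fx≡u ε = x , fx≡u
      path-lift {x} refl (a ◅ p) with l , us , nd ← nodeAt C x with u∈ ← arc-node D (node-map f nd) a =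
        path-lift (sym (trans (lookup-index u∈) (Vec.lookup-map (index u∈) (vmap f) us))) p

      preimage : ∀ y → ∃ λ x → vmap f x ≡ y
      preimage y = path-lift f-root (reachable D y)

      preimageᴱ : ∀ b → ∃ λ a → emap f a ≡ b
      preimageᴱ b with x , fx ← preimage (res (graph D) b) with uniqueEdge C x
      ... | a , refl , _ = a , edge-injective D (trans (res-map f a) fx)

      size-≤ : size D ≤ size C
      size-≤ = injective⇒size-≤ {D} {C} (proj₁ ∘ preimage) λ {y} {y′} eq →
        trans (sym (proj₂ (preimage y))) (trans (cong (vmap f) eq) (proj₂ (preimage y′)))

      -- Chosen preimages form a section of the vertex map, so injectivity is a pigeonhole argument
      -- once nodes are numbered.
      size-≤⇒injective : size C ≤ size D → Injective _≡_ _≡_ (vmap f)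
      size-≤⇒injective C≤D {x} {x′} eq = begin
        x                                ≡⟨ Index.strictlyInverseʳ C x ⟨
        Index.from C (Index.to C x)      ≡⟨ cong (Index.from C) (section⇒injective f̂ ŝ f̂∘ŝ C≤D f̂-eq) ⟩
        Index.from C (Index.to C x′)     ≡⟨ Index.strictlyInverseʳ C x′ ⟩
        x′                               ∎
        where
        open ≡-Reasoning
        f̂ = Index.to D ∘ vmap f ∘ Index.from C
        ŝ = Index.to C ∘ proj₁ ∘ preimage ∘ Index.from D
        f̂∘ŝ : ∀ j → f̂ (ŝ j) ≡ j
        f̂∘ŝ j = trans (cong (Index.to D) (trans (cong (vmap f) (Index.strictlyInverseʳ C _))
                                                (proj₂ (preimage _))))
                      (Index.strictlyInverseˡ D j)
        f̂-eq : f̂ (Index.to C x) ≡ f̂ (Index.to C x′)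
        f̂-eq = cong (Index.to D) (trans (cong (vmap f) (Index.strictlyInverseʳ C x))
                 (trans eq (cong (vmap f) (sym (Index.strictlyInverseʳ C x′)))))

      size-≤⇒≅ : size C ≤ size D → C ≅ D
      size-≤⇒≅ C≤D = record
        { morphism  = f
        ; bijective = (size-≤⇒injective C≤D , λ y → proj₁ (preimage y) , λ { refl → proj₂ (preimage y) })
                    , (proj₂ (vmap-injective⇒injective (size-≤⇒injective C≤D))
                      , λ b → proj₁ (preimageᴱ b) , λ { refl → proj₂ (preimageᴱ b) })
        }

  collapse-size : ∀ {C D : Circuit n} → CollapseStep C D → size D < size C
  collapse-size {C} {D} (f , ¬inj , f-root) = ≰⇒> λ C≤D →
    ¬inj (vmap-injective⇒injective {C} {D} f (size-≤⇒injective {C} {D} f f-root C≤D))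

  collapse-term : ∀ {C D : Circuit n} → CollapseStep C D → term D ≡ term C
  collapse-term {C} {D} (f , _ , f-root) = term-map {C} {D} f f-root

  ≅-root : ∀ {C D : Circuit n} (i : C ≅ D) → vmap (_≅_.morphism i) (root C) ≡ root D
  ≅-root {C} {D} i with x , fx ← proj₂ (proj₁ (_≅_.bijective i)) (root D) =
    path-antisym D (subst (Path (graph D) _) (fx refl) (path-map (_≅_.morphism i) (reachable C x)))
                   (reachable D _)

  ≅-term : ∀ {C D : Circuit n} → C ≅ D → term C ≡ term D
  ≅-term {C} {D} i = sym (term-map {C} {D} (_≅_.morphism i) (≅-root i))

  ≅-size : ∀ {C D : Circuit n} → C ≅ D → size C ≡ size D
  ≅-size {C} {D} i = ≤-antisym
    (injective⇒size-≤ {C} {D} (vmap (_≅_.morphism i)) (proj₁ (proj₁ (_≅_.bijective i))))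
    (size-≤ {C} {D} (_≅_.morphism i) (≅-root i))

  ≅-isEquivalence : IsEquivalence (_≅_ {n})
  ≅-isEquivalence = record
    { refl  = record { morphism = idᴹ ; bijective = (id , λ x → x , id) , (id , λ a → a , id) }
    ; sym   = inverse
    ; trans = compose
    }
    where
    open _≅_

    inverse : ∀ {C D : Circuit n} → C ≅ D → D ≅ C
    inverse {C} {D} i = record
      { morphism  = record
        { vmap  = from
        ; emap  = fromᴱ
        ; lab-≡ = λ b → trans (sym (lab-≡ (morphism i) (fromᴱ b))) (cong (lab (graph D)) (to∘fromᴱ b))
        ; att-≡ = λ b → List.map-injective (proj₁ (proj₁ (bijective i))) (begin
            List.map to (toList (att (graph C) (fromᴱ b)))        ≡⟨ Vec.toList-map to _ ⟨
            toList (Vec.map to (att (graph C) (fromᴱ b)))         ≡⟨ att-≡ (morphism i) (fromᴱ b) ⟨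
            toList (att (graph D) (emap (morphism i) (fromᴱ b)))  ≡⟨ cong (toList ∘ att (graph D)) (to∘fromᴱ b) ⟩
            toList (att (graph D) b)                              ≡⟨ cong toList (Vec.map-id _) ⟨
            toList (Vec.map id (att (graph D) b))                 ≡⟨ cong toList (Vec.map-cong to∘from _) ⟨
            toList (Vec.map (to ∘ from) (att (graph D) b))        ≡⟨ cong toList (Vec.map-∘ to from _) ⟩
            toList (Vec.map to (Vec.map from (att (graph D) b)))  ≡⟨ Vec.toList-map to _ ⟩
            List.map to (toList (Vec.map from (att (graph D) b))) ∎)
        }
      ; bijective = Symmetry.bijective (proj₁ (bijective i)) refl sym trans (cong _)
                  , Symmetry.bijective (proj₂ (bijective i)) refl sym trans (cong _)
      }
      where
      open ≡-Reasoning
      to    = vmap (morphism i)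
      from  = proj₁ ∘ proj₂ (proj₁ (bijective i))
      fromᴱ = proj₁ ∘ proj₂ (proj₂ (bijective i))

      to∘from : ∀ y → to (from y) ≡ y
      to∘from y = proj₂ (proj₂ (proj₁ (bijective i)) y) refl

      to∘fromᴱ : ∀ b → emap (morphism i) (fromᴱ b) ≡ b
      to∘fromᴱ b = proj₂ (proj₂ (proj₂ (bijective i)) b) refl

    compose : ∀ {C D F : Circuit n} → C ≅ D → D ≅ F → C ≅ F
    compose i j = record
      { morphism  = morphism j ∘ᴹ morphism i
      ; bijective = Composition.bijective _≡_ _≡_ _≡_ (proj₁ (bijective i)) (proj₁ (bijective j))
                  , Composition.bijective _≡_ _≡_ _≡_ (proj₂ (bijective i)) (proj₂ (bijective j))
      }

-- Criteria for termination and confluence on classes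

module _ {a b ℓ₁ ℓ₂ : Level} {A : Set a} {B : Set b} {_≈_ : Rel A ℓ₁} {_⟶_ : Rel A ℓ₂} where

  measure⇒terminating : ∀ {r} {_⊏_ : Rel B r} → WellFounded _⊏_ → (μ : A → B) →
                        (∀ {x y} → x ≈ y → μ x ≡ μ y) → (∀ {x y} → x ⟶ y → μ y ⊏ μ x) →
                        Terminating _≈_ (OnClasses _≈_ _⟶_)
  measure⇒terminating {_⊏_ = _⊏_} wf μ μ-≈ μ-⟶ (path , steps) = go 0 (wf _)
    where
    decrease : ∀ {x y} → OnClasses _≈_ _⟶_ x y → μ y ⊏ μ x
    decrease (x′ , y′ , x′≈x , y′≈y , s) = subst₂ _⊏_ (μ-≈ y′≈y) (μ-≈ x′≈x) (μ-⟶ s)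

    go : ∀ i → ¬ Acc _⊏_ (μ (path i))
    go i (acc rs) = go (suc i) (rs (decrease (steps i)))

  normalForms⇒confluent : (N : A → B) (nform : B → A) →
                          (∀ {x y} → x ≈ y → N x ≡ N y) → (∀ {x y} → x ⟶ y → N x ≡ N y) →
                          (∀ x → StarUpTo _≈_ (OnClasses _≈_ _⟶_) x (nform (N x))) →
                          Confluent _≈_ (OnClasses _≈_ _⟶_)
  normalForms⇒confluent N nform N-≈ N-⟶ normalise {x} {y} {y′} s s′ =
    nform (N x) , reduct s , reduct s′
    where
    invariant : ∀ {x y} → StarUpTo _≈_ (OnClasses _≈_ _⟶_) x y → N x ≡ N y
    invariant (done x≈y) = N-≈ x≈y
    invariant (step (x′ , y′ , x′≈x , y′≈y , s) ss) =
      trans (sym (N-≈ x′≈x)) (trans (N-⟶ s) (trans (N-≈ y′≈y) (invariant ss)))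

    reduct : ∀ {y} → StarUpTo _≈_ (OnClasses _≈_ _⟶_) x y →
             StarUpTo _≈_ (OnClasses _≈_ _⟶_) y (nform (N x))
    reduct {y} s = subst (λ b → StarUpTo _≈_ (OnClasses _≈_ _⟶_) y (nform b))
                     (sym (invariant s)) (normalise y)

-- Convergence of the two systems

module _ {n : ℕ} where

  -- The parameter `share` is where the systems differ: passing to the collapsed circuit is an
  -- isomorphism or a collapse step in one, and a bisimilarity in the other.
  module Strategy
    {_≈_ : Rel (Circuit n) 0ℓ} (≈-isEquivalence : IsEquivalence _≈_)
    {_⟶_ : Rel (Circuit n) (lsuc 0ℓ)} (proper : ∀ {C D} → ProperStep C D → C ⟶ D)
    (share : ∀ C → C ≈ collapsed (term C) ⊎ C ⟶ collapsed (term C))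
    where

    private module ≈ = IsEquivalence ≈-isEquivalence

    _⟶*_ : Rel (Circuit n) (lsuc 0ℓ)
    _⟶*_ = StarUpTo _≈_ (OnClasses _≈_ _⟶_)

    ≈-⟶* : ∀ {C D F} → C ≈ D → D ⟶* F → C ⟶* F
    ≈-⟶* C≈D (done D≈F) = done (≈.trans C≈D D≈F)
    ≈-⟶* C≈D (step (D′ , F′ , D′≈D , F′≈F , s) ss) =
      step (D′ , F′ , ≈.trans D′≈D (≈.sym C≈D) , F′≈F , s) ss

    share-⟶* : ∀ C {F} → collapsed (term C) ⟶* F → C ⟶* F
    share-⟶* C ss with share C
    ... | inj₁ C≈ = ≈-⟶* C≈ ss
    ... | inj₂ s  = step (C , collapsed (term C) , ≈.refl , ≈.refl , s) ss

    normalise : ∀ C → C ⟶* collapsed (nf (term C))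
    normalise C = go C (<-wellFounded (weight (term C)))
      where
      go : ∀ C → Acc _<_ (weight (term C)) → C ⟶* collapsed (nf (term C))
      go C (acc rs) = Sum.[ reducible , normal ]′ (reducible? (term C))
        where
        normal : nf (term C) ≡ term C → C ⟶* collapsed (nf (term C))
        normal eq = share-⟶* C (done (≈.reflexive (cong collapsed (sym eq))))

        reducible : Reducible (term C) → C ⟶* collapsed (nf (term C))
        reducible red = share-⟶* C (step (collapsed (term C) , D , ≈.refl , ≈.refl , proper s)
          (subst (λ t → D ⟶* collapsed t) (≺-nf D≺C) (go D (rs (≺-weight D≺C)))))
          where
          D = proj₁ (reduce red)
          s = proj₂ (reduce red)
          D≺C : term D ≺ term C
          D≺C = subst (term D ≺_) (term-collapsed (term C)) (properStep-≺ s)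

  -- The weight comes first because a proper step may add nodes, as `0▷¬1` does, whereas a collapse
  -- step keeps the term.
  measure : Circuit n → ℕ × ℕ
  measure C = weight (term C) , size C

  𝒮-measure : ∀ {C D} → 𝒮 n C D → ×-Lex _≡_ _<_ _<_ (measure D) (measure C)
  𝒮-measure         (inj₁ s) = inj₁ (≺-weight (properStep-≺ s))
  𝒮-measure {C} {D} (inj₂ s) =
    inj₂ (cong weight (collapse-term {C = C} {D} s) , collapse-size {C = C} {D} s)

  𝒮-nf : ∀ {C D} → 𝒮 n C D → nf (term C) ≡ nf (term D)
  𝒮-nf         (inj₁ s) = sym (≺-nf (properStep-≺ s))
  𝒮-nf {C} {D} (inj₂ s) = sym (cong nf (collapse-term {C = C} {D} s))

  -- Comparing sizes decides whether the collapse morphism is injective: being onto, it is an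
  -- isomorphism as soon as the target is no smaller than the source.
  𝒮-share : ∀ C → C ≅ collapsed (term C) ⊎ 𝒮 n C (collapsed (term C))
  𝒮-share C = Sum.[ iso , strict ]′ (≤-<-connex (size C) (size S))
    where
    S = collapsed (term C)

    iso : size C ≤ size S → C ≅ S ⊎ 𝒮 n C S
    iso C≤S = inj₁ (size-≤⇒≅ {C = C} {S} (collapse C) refl C≤S)

    strict : size S < size C → C ≅ S ⊎ 𝒮 n C S
    strict S<C = inj₂ (inj₂ (collapse C ,
      (λ (inj , _) → <⇒≱ S<C (injective⇒size-≤ {C = C} {S} (vmap (collapse C)) inj)) , refl))

  𝒮-convergent : ConvergentUpTo _≅_ (𝒮 n)
  𝒮-convergent =
    measure⇒terminating {_≈_ = _≅_} (×-wellFounded <-wellFounded <-wellFounded) measure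
      (λ i → cong₂ _,_ (cong weight (≅-term i)) (≅-size i)) 𝒮-measure ,
    normalForms⇒confluent (nf ∘ term) collapsed (cong nf ∘ ≅-term) 𝒮-nf
      (Strategy.normalise ≅-isEquivalence inj₁ 𝒮-share)

  𝒮′-convergent : ConvergentUpTo Bisimilar (𝒮′ n)
  𝒮′-convergent =
    measure⇒terminating {_≈_ = Bisimilar} <-wellFounded (weight ∘ term)
      (λ {C} {D} → cong weight {term C} {term D}) (λ s → ≺-weight (properStep-≺ s)) ,
    normalForms⇒confluent (nf ∘ term) collapsed
      (λ {C} {D} → cong nf {term C} {term D}) (λ s → sym (≺-nf (properStep-≺ s)))
      (Strategy.normalise (On.isEquivalence term isEquivalence) id
        λ C → inj₁ (sym (term-collapsed (term C))))

theorem13 : (n : ℕ) → ConvergentUpTo _≅_ (𝒮 n) × ConvergentUpTo Bisimilar (𝒮′ n)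
theorem13 n = 𝒮-convergent , 𝒮′-convergent
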